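{- For every integer $k\ge1$, $$E^{(k-1)(k-2)\cdots1k}_{1\text{ - }32}(x)=\begin{cases}e^{e^x}\displaystyle\int_0^x e^{ -e^t}\sum_{n\ge k-1}\frac{t^n}{n!}\,dt,&\text{if }k\ge2,\\[2mm] e^{e^x-1},&\text{if }k=1.\end{cases}$$
   Context: A permutation $\pi=\pi_1\cdots\pi_n$ of $\{1,\dots,n\}$ contains the generalized pattern $1\text{ - }32$ if there are indices $i<j<n$ such that $\pi_i\pi_j\pi_{j+1}$ is order-isomorphic to $132$; otherwise it avoids it. A permutation $\pi$ begins with a pattern $p=p_1\cdots p_k$ if $n\ge k$ and $\pi_1\cdots\pi_k$ is order-isomorphic to $p$; by convention, the empty permutation is also regarded as beginning with the pattern $1$ (the case $k=1$). The pattern $(k-1)(k-2)\cdots1k$ consists of $k-1,k-2,\dots,1$ in decreasing order followed by $k$ (for $k=1$ it is $1$, for $k=2$ it is $12$). $E^p_q(x)=\sum_{n\ge0}N^p_q(n)\frac{x^n}{n!}$, where $N^p_q(n)$ is the number of permutations of $\{1,\dots,n\}$ that avoid $q$ and begin with $p$. Identities are identities of power series in $x$. -}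

module Defs where

open import Algebra.Bundles using (CommutativeRing)
open import Algebra.Morphism.Structures using (IsMonoidHomomorphism; IsRingHomomorphism)
import Algebra.Properties.Monoid.Sum as Sum
open import Data.Bool.Base using (if_then_else_)
open import Data.Fin.Base as Fin using (Fin; toℕ; inject≤)
open import Data.Fin.Properties as Fin using (all?; any?)
open import Data.Integer.Base using (+_)
open import Data.List.Base as List
  using (List; []; _∷_; [_]; _++_; length; filter; cartesianProductWith; allFin; downFrom)
import Data.List.Properties as List
open import Data.Nat.Base using (ℕ; zero; suc; _∸_; _<_; _≤_; _≤ᵇ_; _!)
open import Data.Nat.Properties as ℕ using (_<?_; _≤?_; _!≢0)
open import Data.Product.Base using (Σ; ∃; _×_; _,_; uncurry)
open import Data.Rational.Base as ℚ using (ℚ)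
open import Data.Sum.Base using (_⊎_)
open import Data.Vec.Base as Vec using (Vec; lookup)
import Data.Vec.Relation.Unary.AllPairs as AllPairs
open import Data.Vec.Relation.Unary.Unique.Propositional using (Unique)
open import Function.Base using (_∘_)
open import Function.Bundles using (_⇔_; mk⇔; Equivalence)
open import Level using (_⊔_) renaming (suc to lsuc)
open import Relation.Binary.PropositionalEquality using (_≡_)
open import Relation.Nullary using (Dec; yes; no; ¬_)
open import Relation.Nullary.Decidable using (map′; ¬?; _×-dec_; _→-dec_; _⊎-dec_)

------------------------------------------------------------------------
-- Permutations and patterns

-- A permutation of {1,…,n} is given in one-line notation, as a word of
-- length n with distinct letters; the letter v is the element of Fin n
-- with toℕ equal to v ∸ 1.

Word : ℕ → Set
Word n = Vec (Fin n) n

IsPermutation : ∀ {n} → Word n → Set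
IsPermutation π = Unique π

OrderIsomorphic : ∀ {k} → (u v : Fin k → ℕ) → Set
OrderIsomorphic u v = ∀ i j → (u i < u j) ⇔ (v i < v j)

Contains1-32 : ∀ {n} → Word n → Set
Contains1-32 {n} π =
  ∃ λ (i : Fin n) → ∃ λ (j : Fin n) → ∃ λ (j′ : Fin n) →
    i Fin.< j × toℕ j′ ≡ suc (toℕ j) ×
    OrderIsomorphic (toℕ ∘ lookup (lookup π i Vec.∷ lookup π j Vec.∷ lookup π j′ Vec.∷ Vec.[]))
                    (lookup (1 Vec.∷ 3 Vec.∷ 2 Vec.∷ Vec.[]))

Avoids1-32 : ∀ {n} → Word n → Set
Avoids1-32 π = ¬ Contains1-32 π

-- The second alternative is the convention that the empty permutation
-- begins with the pattern 1.

BeginsWith : List ℕ → ∀ {n} → Word n → Set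
BeginsWith p {n} π =
  (Σ (length p ≤ n) λ k≤n →
     OrderIsomorphic (λ i → toℕ (lookup π (inject≤ i k≤n))) (List.lookup p))
  ⊎ (p ≡ [ 1 ] × n ≡ 0)

-- (k-1)(k-2)⋯1k, for k ≥ 1

decreasingThenMax : ℕ → List ℕ
decreasingThenMax k = List.map suc (downFrom (k ∸ 1)) ++ [ k ]

Counted : List ℕ → ∀ {n} → Word n → Set
Counted p π = IsPermutation π × Avoids1-32 π × BeginsWith p π

isPermutation? : ∀ {n} (π : Word n) → Dec (IsPermutation π)
isPermutation? = AllPairs.allPairs? (λ x y → ¬? (x Fin.≟ y))

orderIsomorphic? : ∀ {k} (u v : Fin k → ℕ) → Dec (OrderIsomorphic u v)
orderIsomorphic? u v = all? λ i → all? λ j →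
  map′ (uncurry mk⇔) (λ e → Equivalence.to e , Equivalence.from e)
       (((u i <? u j) →-dec (v i <? v j)) ×-dec ((v i <? v j) →-dec (u i <? u j)))

contains1-32? : ∀ {n} (π : Word n) → Dec (Contains1-32 π)
contains1-32? π = any? λ i → any? λ j → any? λ j′ →
  (i Fin.<? j) ×-dec (toℕ j′ ℕ.≟ suc (toℕ j)) ×-dec orderIsomorphic? _ _

beginsWith? : ∀ p {n} (π : Word n) → Dec (BeginsWith p π)
beginsWith? p {n} π = prefix? ⊎-dec (List.≡-dec ℕ._≟_ p [ 1 ] ×-dec (n ℕ.≟ 0))
  where
  prefix? : Dec (Σ (length p ≤ n) λ k≤n →
    OrderIsomorphic (λ i → toℕ (lookup π (inject≤ i k≤n))) (List.lookup p))
  prefix? with length p ≤? n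
  ... | no  k≰n = no λ (k≤n , _) → k≰n k≤n
  ... | yes k≤n = map′ (k≤n ,_)
    (λ { (q , iso) → subst′ (ℕ.≤-irrelevant q k≤n) iso })
    (orderIsomorphic? _ _)
    where
    subst′ : ∀ {q r : length p ≤ n} → q ≡ r →
      OrderIsomorphic (λ i → toℕ (lookup π (inject≤ i q))) (List.lookup p) →
      OrderIsomorphic (λ i → toℕ (lookup π (inject≤ i r))) (List.lookup p)
    subst′ _≡_.refl iso = iso

counted? : ∀ p {n} (π : Word n) → Dec (Counted p π)
counted? p π = isPermutation? π ×-dec ¬? (contains1-32? π) ×-dec beginsWith? p π

-- All words of length n over Fin m, each listed once.

words : ∀ m n → List (Vec (Fin m) n)
words m zero    = [ Vec.[] ]
words m (suc n) = cartesianProductWith Vec._∷_ (allFin m) (words m n)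

-- N p n is the number N^p_q(n) for q = 1-32.

N : List ℕ → ℕ → ℕ
N p n = length (filter (counted? p) (words n n))

------------------------------------------------------------------------
-- Coefficients

-- The series e^{e^x} has constant term e, so its coefficients are not
-- rational. They are taken in an arbitrary commutative ℚ-algebra with an
-- exponential map from its additive to its multiplicative monoid, which
-- makes exp c available for a constant term c. The intended instance is ℝ
-- with the real exponential function.

record Exponentialℚ-Algebra c ℓ : Set (lsuc (c ⊔ ℓ)) where
  field
    commutativeRing : CommutativeRing c ℓ

  open CommutativeRing commutativeRing public

  field
    fromℚ              : ℚ → Carrier
    fromℚ-homomorphism : IsRingHomomorphism ℚ.+-*-rawRing rawRing fromℚ
    exp                : Carrier → Carrier
    exp-homomorphism   : IsMonoidHomomorphism +-rawMonoid *-rawMonoid exp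

------------------------------------------------------------------------
-- Formal power series, as sequences of coefficients of x^n

module PowerSeries {c ℓ} (R : Exponentialℚ-Algebra c ℓ) where

  open Exponentialℚ-Algebra R
  open Sum +-monoid using (sum⁺-syntax)

  Series : Set c
  Series = ℕ → Carrier

  infix  4 _≋_
  infixl 6 _⊖_
  infixl 7 _⊛_
  infixr 8 _^^_

  _≋_ : Series → Series → Set ℓ
  F ≋ G = ∀ n → F n ≈ G n

  constant : Carrier → Series
  constant a zero    = a
  constant a (suc _) = 0#

  𝟙 : Series
  𝟙 = constant 1#

  X : Series
  X 1 = 1#
  X _ = 0#

  ⊖_ : Series → Series
  (⊖ F) n = - F n

  _⊖_ : Series → Series → Series
  (F ⊖ G) n = F n - G n

  _⊛_ : Series → Series → Series
  (F ⊛ G) n = ∑[ i ≤ n ] (F (toℕ i) * G (n ∸ toℕ i))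

  _^^_ : Series → ℕ → Series
  F ^^ zero  = 𝟙
  F ^^ suc m = F ⊛ (F ^^ m)

  -- a / n!
  _over_! : ℕ → ℕ → Carrier
  a over n ! = fromℚ (ℚ._/_ (+ a) (n !) {{n !≢0}})

  -- e^F = exp (F 0) · Σ_m (F - F 0)^m / m!. Since F - F 0 has no constant
  -- term, only the summands with m ≤ n contribute to the coefficient of x^n.

  e^_ : Series → Series
  (e^ F) n =
    exp (F 0) * (∑[ m ≤ n ] ((1 over toℕ m !) * ((F ⊖ constant (F 0)) ^^ toℕ m) n))

  ∫₀ : Series → Series
  ∫₀ F zero    = 0#
  ∫₀ F (suc n) = fromℚ ((+ 1) ℚ./ suc n) * F n

  -- Σ_{n ≥ r} x^n / n!
  expTail : ℕ → Series
  expTail r n = if r ≤ᵇ n then 1 over n ! else 0#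

  E : List ℕ → Series
  E p n = N p n over n !

module Submission where

open import Defs
open import Algebra.Morphism.Structures using (module IsMonoidHomomorphism; module IsRingHomomorphism)
import Algebra.Properties.Group as GroupProperties
import Algebra.Properties.Ring as RingProperties
import Algebra.Properties.Semiring.Mult as Mult
import Algebra.Properties.Semiring.Sum as SemiringSum
import Algebra.Solver.Ring.NaturalCoefficients.Default as NatSolver
open import Data.Bool.Base using (Bool; true; false; if_then_else_)
open import Data.Empty using (⊥-elim)
open import Data.Fin.Base as Fin using (Fin; toℕ; inject≤)
open import Data.Fin.Patterns using (0F; 1F; 2F)
import Data.Fin.Properties as Fin
open import Data.Integer.Base as ℤ using (+_)
import Data.Integer.Properties as ℤ
open import Data.List.Base as List
  using (List; []; _∷_; [_]; _++_; length; map; concatMap; downFrom; filter)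
import Data.List.Properties as List
open import Data.List.Membership.Propositional using (_∈_; _∉_)
open import Data.List.Membership.Propositional.Properties
  using (∈-map⁺; ∈-map⁻; ∈-++⁺ˡ; ∈-++⁺ʳ; ∈-++⁻; ∈-∃++; ∈-concat⁺′; ∈-concat⁻′; ∈-lookup;
         ∈-downFrom⁻; ∈-filter⁺; ∈-filter⁻; ∈-allFin; ∈-cartesianProductWith⁺)
open import Data.List.Membership.Propositional.Properties.WithK using (unique∧set⇒bag)
import Data.List.Membership.DecPropositional as DecMembership
open import Data.List.Relation.Binary.BagAndSetEquality using (∼bag⇒↭)
open import Data.List.Relation.Binary.Disjoint.Propositional using (Disjoint)
open import Data.List.Relation.Binary.Permutation.Propositional.Properties using (↭-length)
open import Data.List.Relation.Unary.All as All using (All; []; _∷_)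
import Data.List.Relation.Unary.All.Properties as All
open import Data.List.Relation.Unary.AllPairs as AllPairs using (AllPairs; []; _∷_)
import Data.List.Relation.Unary.AllPairs.Properties as AllPairs
open import Data.List.Relation.Unary.Any using (here; there; index)
import Data.List.Relation.Unary.Any.Properties as Any
open import Data.List.Relation.Unary.Linked using (Linked; []; [-]; _∷_)
import Data.List.Relation.Unary.Linked.Properties as Linked
open import Data.List.Relation.Unary.Unique.Propositional using (Unique)
import Data.List.Relation.Unary.Unique.Propositional.Properties as Unique
open import Data.Nat.Base as ℕ
  using (ℕ; zero; suc; _∸_; _<_; _>_; _≤_; _≤ᵇ_; z≤n; s≤s; z<s; s<s; s<s⁻¹; NonZero; _!)
open import Data.Nat.ListAction.Properties using (sum-++)
open import Data.Nat.Properties as ℕ using (<-cmp; _!≢0)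
open import Data.Product.Base using (∃; ∃₂; _,_; proj₁; proj₂)
open import Data.Rational.Base as ℚ using (ℚ)
import Data.Rational.Properties as ℚ
import Data.Rational.Unnormalised.Base as ℚᵘ
import Data.Rational.Unnormalised.Properties as ℚᵘ
open import Data.Sum.Base using (_⊎_; inj₁; inj₂)
open import Data.Unit.Base using (⊤)
open import Data.Vec.Base as Vec using (Vec; lookup; []; _∷_)
import Data.Vec.Properties as Vec
import Data.Vec.Relation.Unary.All as VecAll
import Data.Vec.Relation.Unary.AllPairs as VecAllPairs
open import Data.Vec.Relation.Unary.Unique.Propositional using () renaming (Unique to VecUnique)
open import Function.Base using (_∘_; id)
open import Function.Bundles using (_⇔_; mk⇔; Equivalence)
open import Relation.Binary.Core using (Rel)
open import Relation.Binary.Definitions using (tri<; tri≈; tri>)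
open import Relation.Binary.PropositionalEquality as ≡
  using (_≡_; _≢_; cong; cong₂; subst)
import Relation.Binary.Reasoning.Setoid as SetoidReasoning
open import Relation.Nullary using (¬_; yes; no; contradiction)

-- Every descent of a permutation avoiding 1-32 ends in a left-to-right
-- minimum, so removing the smallest letter and the increasing run after it
-- leaves an arbitrary shorter avoider on an arbitrary subset of the letters.
-- The removal preserves beginning with (k-1)⋯1k, except for the single
-- permutation (k-1)⋯1k⋯(n+1), which gives
-- N(n+1) = Σ_i C(n,i) N(i) + [n ≥ k-1] for k ≥ 2, and the Bell recurrence for
-- k = 1. Hence E solves E' = e^x E + Σ_{n≥k-1} x^n/n! (or E' = e^x E), and a
-- linear differential equation with given constant term has one solution.

-- Power series

-- Write the letters from 0 on. An adjacent descent y z completes a 1-32 as soon as some earlier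
-- letter is below z. So nothing after the letter 0 descends, and an avoider of size n+1 is u 0 v
-- with v increasing. Conversely, if u avoids and v increases, the only descent not inside u is the
-- one into 0, and no letter lies below 0, so u 0 v avoids. An avoider is therefore the same as the
-- set of letters after its 0 together with an arbitrary avoider on the remaining letters (`attach`,
-- `detach`). Summing over these sets gives the binomial transform.
--
-- Let k ≥ 2. If the required initial segment lies inside u, relabelling u keeps it. If it reaches
-- past 0, its decreasing run must end at 0, and its last letter y, which exceeds all of u, is the
-- head of v. A decreasing word below y followed by an increasing word from y on leaves no freedom
-- (`valley-characterisation`): this is one extra word, present exactly when n ≥ k-1, and it never
-- arises in the first case (`attach≢valley`). For k = 1 every avoider counts, including the empty
-- one, and there is no extra term.
--
-- For exponential generating functions the index shift is differentiation and the binomial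
-- transform is multiplication by e^x (`e^X⊛egf`), so the recurrence reads Y' = e^x Y + T. The
-- closed forms satisfy the same equation, by the chain rule `D-e^` for k = 1 and by variation of
-- constants (`∫-solution`) for k ≥ 2, where `e^⊛e^⊖` supplies the inverse of e^{e^x}. The constant
-- terms agree, being 1 and 0 respectively, and `linear-ODE-unique` concludes.

/-*-cancel : ∀ a d .{{_ : NonZero d}} → (+ a ℚ./ d) ℚ.* (+ d ℚ./ 1) ≡ + a ℚ./ 1
-- `ℚ./` divides out a gcd; among unnormalised fractions the claim is a plain cross-multiplication.
/-*-cancel a (suc d) = ℚ.toℚᵘ-injective (begin
  ℚ.toℚᵘ ((+ a ℚ./ suc d) ℚ.* (+ suc d ℚ./ 1))
    ≈⟨ ℚ.toℚᵘ-homo-* (+ a ℚ./ suc d) (+ suc d ℚ./ 1) ⟩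
  ℚ.toℚᵘ (+ a ℚ./ suc d) ℚᵘ.* ℚ.toℚᵘ (+ suc d ℚ./ 1)
    ≈⟨ ℚᵘ.*-cong (ℚ.toℚᵘ-fromℚᵘ (ℚᵘ.mkℚᵘ (+ a) d)) (ℚ.toℚᵘ-fromℚᵘ (ℚᵘ.mkℚᵘ (+ suc d) 0)) ⟩
  ℚᵘ.mkℚᵘ (+ a) d ℚᵘ.* ℚᵘ.mkℚᵘ (+ suc d) 0
    ≈⟨ ℚᵘ.*≡* (ℤ.*-assoc (+ a) (+ suc d) (+ 1)) ⟩
  ℚᵘ.mkℚᵘ (+ a) 0
    ≈⟨ ℚ.toℚᵘ-fromℚᵘ (ℚᵘ.mkℚᵘ (+ a) 0) ⟨
  ℚ.toℚᵘ (+ a ℚ./ 1) ∎)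
  where
  open SetoidReasoning ℚᵘ.≃-setoid

suc-/1 : ∀ n → + suc n ℚ./ 1 ≡ ℚ.1ℚ ℚ.+ (+ n ℚ./ 1)
suc-/1 n = ℚ.toℚᵘ-injective (begin
  ℚ.toℚᵘ (+ suc n ℚ./ 1)
    ≈⟨ ℚ.toℚᵘ-fromℚᵘ (ℚᵘ.mkℚᵘ (+ suc n) 0) ⟩
  ℚᵘ.mkℚᵘ (+ suc n) 0
    ≈⟨ ℚᵘ.*≡* (≡.cong (λ e → (+ 1 ℤ.+ e) ℤ.* + 1) (≡.sym (ℤ.*-identityʳ (+ n)))) ⟩
  ℚᵘ.1ℚᵘ ℚᵘ.+ ℚᵘ.mkℚᵘ (+ n) 0
    ≈⟨ ℚᵘ.+-congʳ ℚᵘ.1ℚᵘ (ℚ.toℚᵘ-fromℚᵘ (ℚᵘ.mkℚᵘ (+ n) 0)) ⟨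
  ℚᵘ.1ℚᵘ ℚᵘ.+ ℚ.toℚᵘ (+ n ℚ./ 1)
    ≈⟨ ℚ.toℚᵘ-homo-+ ℚ.1ℚ (+ n ℚ./ 1) ⟨
  ℚ.toℚᵘ (ℚ.1ℚ ℚ.+ (+ n ℚ./ 1)) ∎)
  where open SetoidReasoning ℚᵘ.≃-setoid

-- Σ_i C(n,i) f(i), summed by Pascal's rule.
binomialTransform : ℕ → (ℕ → ℕ) → ℕ
binomialTransform zero    f = f 0
binomialTransform (suc n) f = binomialTransform n f ℕ.+ binomialTransform n (f ∘ suc)

module SeriesProperties {c ℓ} (R : Exponentialℚ-Algebra c ℓ) where

  open Exponentialℚ-Algebra R hiding (zero)
  open PowerSeries R
  open Mult semiring using (_×_; ×-homo-+; ×1-homo-*)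
  open SemiringSum semiring using (sum; sum-syntax; sum⁺-syntax; sum-cong-≋; sum-replicate-zero; *-distribˡ-sum)
  open RingProperties ring using (-1*x≈-x)
  open GroupProperties +-group using () renaming (ε⁻¹≈ε to -0#≈0#)
  open NatSolver commutativeSemiring using (solve; _:=_; _:+_; _:*_; con)
  open SetoidReasoning setoid
  module ℚHom = IsRingHomomorphism fromℚ-homomorphism
  module ExpHom = IsMonoidHomomorphism exp-homomorphism

  -- Natural numbers as units of the coefficient ring

  ⟦_⟧ : ℕ → Carrier
  ⟦ n ⟧ = n × 1#

  fromℚ-/1 : ∀ n → fromℚ (+ n ℚ./ 1) ≈ ⟦ n ⟧
  fromℚ-/1 zero    = ℚHom.0#-homo
  fromℚ-/1 (suc n) = begin
    fromℚ (+ suc n ℚ./ 1)           ≡⟨ ≡.cong fromℚ (suc-/1 n) ⟩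
    fromℚ (ℚ.1ℚ ℚ.+ (+ n ℚ./ 1))    ≈⟨ ℚHom.+-homo _ _ ⟩
    fromℚ ℚ.1ℚ + fromℚ (+ n ℚ./ 1)  ≈⟨ +-cong ℚHom.1#-homo (fromℚ-/1 n) ⟩
    1# + ⟦ n ⟧                      ∎

  fromℚ-/-cancel : ∀ a d .{{_ : NonZero d}} → fromℚ (+ a ℚ./ d) * ⟦ d ⟧ ≈ ⟦ a ⟧
  fromℚ-/-cancel a d = begin
    fromℚ (+ a ℚ./ d) * ⟦ d ⟧              ≈⟨ *-congˡ (fromℚ-/1 d) ⟨
    fromℚ (+ a ℚ./ d) * fromℚ (+ d ℚ./ 1)  ≈⟨ ℚHom.*-homo _ _ ⟨
    fromℚ ((+ a ℚ./ d) ℚ.* (+ d ℚ./ 1))    ≡⟨ ≡.cong fromℚ (/-*-cancel a d) ⟩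
    fromℚ (+ a ℚ./ 1)                      ≈⟨ fromℚ-/1 a ⟩
    ⟦ a ⟧                                  ∎

  -- A positive integer is a unit because the ring receives ℚ. Identities between fractions are thus
  -- proved by clearing denominators.
  ⟦⟧-cancel : ∀ d .{{_ : NonZero d}} {x y} → x * ⟦ d ⟧ ≈ y * ⟦ d ⟧ → x ≈ y
  ⟦⟧-cancel d {x} {y} eq = begin
    x                ≈⟨ undo x ⟨
    x * ⟦ d ⟧ * d⁻¹  ≈⟨ *-congʳ eq ⟩
    y * ⟦ d ⟧ * d⁻¹  ≈⟨ undo y ⟩
    y                ∎
    where
    d⁻¹ = fromℚ (+ 1 ℚ./ d)
    undo : ∀ z → z * ⟦ d ⟧ * d⁻¹ ≈ z
    undo z = begin
      z * ⟦ d ⟧ * d⁻¹    ≈⟨ *-assoc z ⟦ d ⟧ d⁻¹ ⟩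
      z * (⟦ d ⟧ * d⁻¹)  ≈⟨ *-congˡ (*-comm ⟦ d ⟧ d⁻¹) ⟩
      z * (d⁻¹ * ⟦ d ⟧)  ≈⟨ *-congˡ (fromℚ-/-cancel 1 d) ⟩
      z * (1# + 0#)      ≈⟨ *-congˡ (+-identityʳ 1#) ⟩
      z * 1#             ≈⟨ *-identityʳ z ⟩
      z                  ∎

  over-*-! : ∀ a n → a over n ! * ⟦ n ! ⟧ ≈ ⟦ a ⟧
  over-*-! a n = fromℚ-/-cancel a (n !) {{n !≢0}}

  ⟦suc⟧-*-over : ∀ a n → ⟦ suc n ⟧ * (a over suc n !) ≈ a over n !
  ⟦suc⟧-*-over a n = ⟦⟧-cancel (n !) {{n !≢0}} (begin
    ⟦ suc n ⟧ * (a over suc n !) * ⟦ n ! ⟧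
      ≈⟨ solve 3 (λ x y z → x :* y :* z := y :* (x :* z)) refl _ _ _ ⟩
    (a over suc n !) * (⟦ suc n ⟧ * ⟦ n ! ⟧)
      ≈⟨ *-congˡ (×1-homo-* (suc n) (n !)) ⟨
    (a over suc n !) * ⟦ suc n ! ⟧
      ≈⟨ over-*-! a (suc n) ⟩
    ⟦ a ⟧
      ≈⟨ over-*-! a n ⟨
    (a over n !) * ⟦ n ! ⟧ ∎)

  over-+ : ∀ a b n → (a ℕ.+ b) over n ! ≈ a over n ! + b over n !
  over-+ a b n = ⟦⟧-cancel (n !) {{n !≢0}} (begin
    (a ℕ.+ b) over n ! * ⟦ n ! ⟧
      ≈⟨ over-*-! (a ℕ.+ b) n ⟩
    ⟦ a ℕ.+ b ⟧
      ≈⟨ ×-homo-+ 1# a b ⟩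
    ⟦ a ⟧ + ⟦ b ⟧
      ≈⟨ +-cong (over-*-! a n) (over-*-! b n) ⟨
    a over n ! * ⟦ n ! ⟧ + b over n ! * ⟦ n ! ⟧
      ≈⟨ distribʳ _ _ _ ⟨
    (a over n ! + b over n !) * ⟦ n ! ⟧ ∎)

  over-0! : ∀ a → a over 0 ! ≈ ⟦ a ⟧
  over-0! a = fromℚ-/1 a

  0-over : ∀ n → 0 over n ! ≈ 0#
  0-over n = ⟦⟧-cancel (n !) {{n !≢0}} (trans (over-*-! 0 n) (sym (zeroˡ _)))

  -- The Cauchy product

  infixl 6 _⊕_

  _⊕_ : Series → Series → Series
  (F ⊕ G) n = F n + G n

  scale : Carrier → Series → Series
  scale a F n = a * F n

  -- Splitting off the summand i = 0, `(F ⊛ G) (suc n)` computes to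
  -- `F 0 * G (suc n) + (shift F ⊛ G) n`. Most product laws below are inductions along this
  -- recursion.
  shift : Series → Series
  shift F = F ∘ suc

  D : Series → Series
  D F n = ⟦ suc n ⟧ * F (suc n)

  -- A coefficient of a product sees only coefficients of the factors up to its own index. This
  -- locality is what makes solutions of differential equations unique and lets the sums in `e^_` be
  -- truncated.
  ⊛-cong-≤ : ∀ n {F F′ G G′} → (∀ i → i ≤ n → F i ≈ F′ i) → (∀ i → i ≤ n → G i ≈ G′ i) →
             (F ⊛ G) n ≈ (F′ ⊛ G′) n
  ⊛-cong-≤ zero    p q = +-congʳ (*-cong (p 0 z≤n) (q 0 z≤n))
  ⊛-cong-≤ (suc n) p q = +-cong (*-cong (p 0 z≤n) (q (suc n) ℕ.≤-refl))
    (⊛-cong-≤ n (λ i i≤n → p (suc i) (s≤s i≤n)) (λ i i≤n → q i (ℕ.m≤n⇒m≤1+n i≤n)))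

  ⊛-cong : ∀ {F F′ G G′} → F ≋ F′ → G ≋ G′ → F ⊛ G ≋ F′ ⊛ G′
  ⊛-cong p q n = ⊛-cong-≤ n (λ i _ → p i) (λ i _ → q i)

  ⊛-congˡ : ∀ F {G G′} → G ≋ G′ → F ⊛ G ≋ F ⊛ G′
  ⊛-congˡ F = ⊛-cong {F} (λ _ → refl)

  ⊛-congʳ : ∀ G {F F′} → F ≋ F′ → F ⊛ G ≋ F′ ⊛ G
  ⊛-congʳ G p = ⊛-cong {G = G} p (λ _ → refl)

  ⊛-distribʳ : ∀ F G H → (F ⊕ G) ⊛ H ≋ F ⊛ H ⊕ G ⊛ H
  ⊛-distribʳ F G H zero =
    solve 3 (λ f g h → (f :+ g) :* h :+ con 0 := (f :* h :+ con 0) :+ (g :* h :+ con 0)) refl _ _ _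
  ⊛-distribʳ F G H (suc n) = begin
    (F 0 + G 0) * H (suc n) + ((shift F ⊕ shift G) ⊛ H) n
      ≈⟨ +-congˡ (⊛-distribʳ (shift F) (shift G) H n) ⟩
    (F 0 + G 0) * H (suc n) + ((shift F ⊛ H) n + (shift G ⊛ H) n)
      ≈⟨ solve 5 (λ f g h x y → (f :+ g) :* h :+ (x :+ y) := (f :* h :+ x) :+ (g :* h :+ y)) refl _ _ _ _ _ ⟩
    (F 0 * H (suc n) + (shift F ⊛ H) n) + (G 0 * H (suc n) + (shift G ⊛ H) n) ∎

  scale-⊛ : ∀ a F G → scale a F ⊛ G ≋ scale a (F ⊛ G)
  scale-⊛ a F G zero =
    solve 3 (λ a f g → a :* f :* g :+ con 0 := a :* (f :* g :+ con 0)) refl _ _ _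
  scale-⊛ a F G (suc n) = begin
    a * F 0 * G (suc n) + (scale a (shift F) ⊛ G) n
      ≈⟨ +-congˡ (scale-⊛ a (shift F) G n) ⟩
    a * F 0 * G (suc n) + a * (shift F ⊛ G) n
      ≈⟨ solve 4 (λ a f g x → a :* f :* g :+ a :* x := a :* (f :* g :+ x)) refl _ _ _ _ ⟩
    a * (F 0 * G (suc n) + (shift F ⊛ G) n) ∎

  ⊛-assoc : ∀ F G H → (F ⊛ G) ⊛ H ≋ F ⊛ (G ⊛ H)
  ⊛-assoc F G H zero =
    solve 3 (λ f g h → (f :* g :+ con 0) :* h :+ con 0 := f :* (g :* h :+ con 0) :+ con 0) refl _ _ _
  ⊛-assoc F G H (suc n) = begin
    -- By the recursion, `shift (F ⊛ G)` is `scale (F 0) (shift G) ⊕ (shift F ⊛ G)`.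
    (F 0 * G 0 + 0#) * H (suc n) + ((scale (F 0) (shift G) ⊕ (shift F ⊛ G)) ⊛ H) n
      ≈⟨ +-congˡ (⊛-distribʳ (scale (F 0) (shift G)) (shift F ⊛ G) H n) ⟩
    (F 0 * G 0 + 0#) * H (suc n) + ((scale (F 0) (shift G) ⊛ H) n + ((shift F ⊛ G) ⊛ H) n)
      ≈⟨ +-congˡ (+-cong (scale-⊛ (F 0) (shift G) H n) (⊛-assoc (shift F) G H n)) ⟩
    (F 0 * G 0 + 0#) * H (suc n) + (F 0 * (shift G ⊛ H) n + (shift F ⊛ (G ⊛ H)) n)
      ≈⟨ solve 5 (λ f g h x y → (f :* g :+ con 0) :* h :+ (f :* x :+ y) := f :* (g :* h :+ x) :+ y) refl _ _ _ _ _ ⟩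
    F 0 * (G 0 * H (suc n) + (shift G ⊛ H) n) + (shift F ⊛ (G ⊛ H)) n ∎

  -- The mirror image of the defining recursion, splitting off the last summand; commutativity is
  -- the comparison of the two.
  ⊛-suc : ∀ F G n → (F ⊛ G) (suc n) ≈ F (suc n) * G 0 + (F ⊛ shift G) n
  ⊛-suc F G zero =
    solve 4 (λ f f′ g g′ → f :* g′ :+ (f′ :* g :+ con 0) := f′ :* g :+ (f :* g′ :+ con 0)) refl _ _ _ _
  ⊛-suc F G (suc n) = begin
    F 0 * G (suc (suc n)) + (shift F ⊛ G) (suc n)
      ≈⟨ +-congˡ (⊛-suc (shift F) G n) ⟩
    F 0 * G (suc (suc n)) + (F (suc (suc n)) * G 0 + (shift F ⊛ shift G) n)
      ≈⟨ solve 3 (λ x y z → x :+ (y :+ z) := y :+ (x :+ z)) refl _ _ _ ⟩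
    F (suc (suc n)) * G 0 + (F 0 * G (suc (suc n)) + (shift F ⊛ shift G) n) ∎

  ⊛-comm : ∀ F G → F ⊛ G ≋ G ⊛ F
  ⊛-comm F G zero    = +-congʳ (*-comm _ _)
  ⊛-comm F G (suc n) = begin
    F 0 * G (suc n) + (shift F ⊛ G) n  ≈⟨ +-cong (*-comm _ _) (⊛-comm (shift F) G n) ⟩
    G (suc n) * F 0 + (G ⊛ shift F) n  ≈⟨ ⊛-suc G F n ⟨
    (G ⊛ F) (suc n)                    ∎

  0-⊛ : ∀ {F} G → (∀ n → F n ≈ 0#) → ∀ n → (F ⊛ G) n ≈ 0#
  0-⊛ G F≈0 zero    = trans (+-congʳ (*-congʳ (F≈0 0))) (solve 1 (λ g → con 0 :* g :+ con 0 := con 0) refl _)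
  0-⊛ G F≈0 (suc n) = begin
    _ * G (suc n) + _   ≈⟨ +-cong (*-congʳ (F≈0 0)) (0-⊛ G (F≈0 ∘ suc) n) ⟩
    0# * G (suc n) + 0# ≈⟨ solve 1 (λ g → con 0 :* g :+ con 0 := con 0) refl _ ⟩
    0#                  ∎

  𝟙-⊛ : ∀ F → 𝟙 ⊛ F ≋ F
  𝟙-⊛ F zero    = solve 1 (λ f → con 1 :* f :+ con 0 := f) refl _
  𝟙-⊛ F (suc n) = begin
    1# * F (suc n) + (shift 𝟙 ⊛ F) n  ≈⟨ +-congˡ (0-⊛ F (λ _ → refl) n) ⟩
    1# * F (suc n) + 0#               ≈⟨ solve 1 (λ f → con 1 :* f :+ con 0 := f) refl _ ⟩
    F (suc n)                         ∎

  ⊛-exchange : ∀ F G H → F ⊛ (G ⊛ H) ≋ G ⊛ (F ⊛ H)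
  ⊛-exchange F G H n = begin
    (F ⊛ (G ⊛ H)) n  ≈⟨ ⊛-assoc F G H n ⟨
    ((F ⊛ G) ⊛ H) n  ≈⟨ ⊛-congʳ H (⊛-comm F G) n ⟩
    ((G ⊛ F) ⊛ H) n  ≈⟨ ⊛-assoc G F H n ⟩
    (G ⊛ (F ⊛ H)) n  ∎

  ⊛-scale : ∀ a F G → F ⊛ scale a G ≋ scale a (F ⊛ G)
  ⊛-scale a F G n = begin
    (F ⊛ scale a G) n  ≈⟨ ⊛-comm F (scale a G) n ⟩
    (scale a G ⊛ F) n  ≈⟨ scale-⊛ a G F n ⟩
    a * (G ⊛ F) n      ≈⟨ *-congˡ (⊛-comm G F n) ⟩
    a * (F ⊛ G) n      ∎

  ⊛-distribˡ : ∀ F G H → F ⊛ (G ⊕ H) ≋ F ⊛ G ⊕ F ⊛ H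
  ⊛-distribˡ F G H n = begin
    (F ⊛ (G ⊕ H)) n            ≈⟨ ⊛-comm F (G ⊕ H) n ⟩
    ((G ⊕ H) ⊛ F) n            ≈⟨ ⊛-distribʳ G H F n ⟩
    (G ⊛ F) n + (H ⊛ F) n      ≈⟨ +-cong (⊛-comm G F n) (⊛-comm H F n) ⟩
    (F ⊛ G) n + (F ⊛ H) n      ∎

  -- Derivation and linear differential equations

  shift-D : ∀ F → shift (D F) ≋ shift (shift F) ⊕ D (shift F)
  shift-D F n = solve 2 (λ d f → (con 1 :+ d) :* f := f :+ d :* f) refl ⟦ suc n ⟧ (F (suc (suc n)))

  D-⊛ : ∀ F G → D (F ⊛ G) ≋ D F ⊛ G ⊕ F ⊛ D G
  D-⊛ F G zero = solve 4
    (λ f f′ g g′ → (con 1 :+ con 0) :* (f :* g′ :+ (f′ :* g :+ con 0)) :=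
      ((con 1 :+ con 0) :* f′ :* g :+ con 0) :+ (f :* ((con 1 :+ con 0) :* g′) :+ con 0))
    refl _ _ _ _
  D-⊛ F G (suc n) = begin
    -- The weight n+2 splits as 1 + `d`. The part `d * x` is a derivative to which induction
    -- applies; the remaining `x` turns `D (shift F)` into `shift (D F)` by `shift-D`.
    (1# + d) * (F 0 * G (suc (suc n)) + x)
      ≈⟨ solve 4 (λ d f g x → (con 1 :+ d) :* (f :* g :+ x) := f :* ((con 1 :+ d) :* g) :+ (x :+ d :* x)) refl d _ _ x ⟩
    F 0 * D G (suc n) + (x + D (shift F ⊛ G) n)
      ≈⟨ +-congˡ (+-congˡ (D-⊛ (shift F) G n)) ⟩
    F 0 * D G (suc n) + (x + (y + z))
      ≈⟨ solve 5 (λ h f x y z → h :+ ((f :+ x) :+ (y :+ z)) := (f :+ (x :+ y)) :+ (h :+ z)) refl _ _ _ _ _ ⟩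
    (F 1 * G (suc n) + ((shift (shift F) ⊛ G) n + y)) + (F 0 * D G (suc n) + z)
      ≈⟨ +-congʳ (+-congˡ (⊛-distribʳ (shift (shift F)) (D (shift F)) G n)) ⟨
    (F 1 * G (suc n) + ((shift (shift F) ⊕ D (shift F)) ⊛ G) n) + (F 0 * D G (suc n) + z)
      ≈⟨ +-congʳ (+-cong (*-congʳ (solve 1 (λ f → (con 1 :+ con 0) :* f := f) refl (F 1)))
                         (⊛-congʳ G (shift-D F) n)) ⟨
    (D F 0 * G (suc n) + (shift (D F) ⊛ G) n) + (F 0 * D G (suc n) + z) ∎
    where
    d = ⟦ suc n ⟧
    x = (shift F ⊛ G) (suc n)
    y = (D (shift F) ⊛ G) n
    z = (shift F ⊛ D G) n

  D-injective : ∀ F G n → D F n ≈ D G n → F (suc n) ≈ G (suc n)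
  D-injective F G n eq = ⟦⟧-cancel (suc n) (trans (*-comm _ _) (trans eq (*-comm _ _)))

  -- The equation expresses (n+1) times coefficient n+1 by coefficients up to n, and n+1 is a unit.
  -- The induction carries agreement of all coefficients up to a bound.
  linear-ODE-unique : ∀ A T {Y Z} → D Y ≋ A ⊛ Y ⊕ T → D Z ≋ A ⊛ Z ⊕ T → Y 0 ≈ Z 0 → Y ≋ Z
  linear-ODE-unique A T {Y} {Z} Y′ Z′ Y₀≈Z₀ n = upTo n n ℕ.≤-refl
    where
    upTo : ∀ n i → i ≤ n → Y i ≈ Z i
    upTo _       zero    _         = Y₀≈Z₀
    upTo (suc n) (suc i) (s≤s i≤n) = D-injective Y Z i (begin
      D Y i              ≈⟨ Y′ i ⟩
      (A ⊛ Y) i + T i    ≈⟨ +-congʳ (⊛-cong-≤ i {A} (λ _ _ → refl) (λ j j≤i → upTo n j (ℕ.≤-trans j≤i i≤n))) ⟩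
      (A ⊛ Z) i + T i    ≈⟨ Z′ i ⟨
      D Z i              ∎)

  D-scale : ∀ a F → D (scale a F) ≋ scale a (D F)
  D-scale a F n = solve 3 (λ d a f → d :* (a :* f) := a :* (d :* f)) refl _ _ _

  D-neg : ∀ F → D (⊖ F) ≋ scale (- 1#) (D F)
  D-neg F n = begin
    ⟦ suc n ⟧ * - F (suc n)          ≈⟨ *-congˡ (-1*x≈-x _) ⟨
    ⟦ suc n ⟧ * (- 1# * F (suc n))   ≈⟨ D-scale (- 1#) F n ⟩
    - 1# * (⟦ suc n ⟧ * F (suc n))   ∎

  D-⊖-constant : ∀ F a → D (F ⊖ constant a) ≋ D F
  D-⊖-constant F a n = *-congˡ (trans (+-congˡ -0#≈0#) (+-identityʳ _))

  D-∫₀ : ∀ F → D (∫₀ F) ≋ F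
  D-∫₀ F n = begin
    ⟦ suc n ⟧ * (inv * F n)   ≈⟨ solve 3 (λ d i f → d :* (i :* f) := (i :* d) :* f) refl _ _ _ ⟩
    (inv * ⟦ suc n ⟧) * F n   ≈⟨ *-congʳ (fromℚ-/-cancel 1 (suc n)) ⟩
    (1# + 0#) * F n           ≈⟨ solve 1 (λ f → (con 1 :+ con 0) :* f := f) refl _ ⟩
    F n                       ∎
    where inv = fromℚ (+ 1 ℚ./ suc n)

  D-𝟙 : ∀ n → D 𝟙 n ≈ 0#
  D-𝟙 n = zeroʳ _

  -- Exponentials of series

  D-^^ : ∀ G m → D (G ^^ suc m) ≋ scale ⟦ suc m ⟧ (D G ⊛ (G ^^ m))
  D-^^ G zero n = begin
    D (G ⊛ 𝟙) n                          ≈⟨ D-⊛ G 𝟙 n ⟩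
    (D G ⊛ 𝟙) n + (G ⊛ D 𝟙) n            ≈⟨ +-congˡ (⊛-comm G (D 𝟙) n) ⟩
    (D G ⊛ 𝟙) n + (D 𝟙 ⊛ G) n            ≈⟨ +-congˡ (0-⊛ G D-𝟙 n) ⟩
    (D G ⊛ 𝟙) n + 0#                     ≈⟨ solve 1 (λ x → x :+ con 0 := (con 1 :+ con 0) :* x) refl _ ⟩
    ⟦ 1 ⟧ * (D G ⊛ 𝟙) n                  ∎
  D-^^ G (suc m) n = begin
    D (G ⊛ (G ^^ suc m)) n
      ≈⟨ D-⊛ G (G ^^ suc m) n ⟩
    x + (G ⊛ D (G ^^ suc m)) n
      ≈⟨ +-congˡ (⊛-congˡ G (D-^^ G m) n) ⟩
    x + (G ⊛ scale ⟦ suc m ⟧ (D G ⊛ (G ^^ m))) n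
      ≈⟨ +-congˡ (⊛-scale ⟦ suc m ⟧ G (D G ⊛ (G ^^ m)) n) ⟩
    x + ⟦ suc m ⟧ * (G ⊛ (D G ⊛ (G ^^ m))) n
      ≈⟨ +-congˡ (*-congˡ (⊛-exchange G (D G) (G ^^ m) n)) ⟩
    x + ⟦ suc m ⟧ * x
      ≈⟨ solve 2 (λ x d → x :+ d :* x := (con 1 :+ d) :* x) refl x ⟦ suc m ⟧ ⟩
    ⟦ suc (suc m) ⟧ * x ∎
    where x = (D G ⊛ (G ^^ suc m)) n

  ^^-vanishes : ∀ {G} → G 0 ≈ 0# → ∀ m n → n < m → (G ^^ m) n ≈ 0#
  ^^-vanishes {G} G₀≈0 (suc m) zero    _         =
    trans (+-congʳ (*-congʳ G₀≈0)) (solve 1 (λ x → con 0 :* x :+ con 0 := con 0) refl _)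
  ^^-vanishes {G} G₀≈0 (suc m) (suc n) (s≤s n<m) = begin
    G 0 * (G ^^ m) (suc n) + (shift G ⊛ (G ^^ m)) n
      ≈⟨ +-cong (*-congʳ G₀≈0) (⊛-cong-≤ n {shift G} (λ _ _ → refl)
           (λ i i≤n → ^^-vanishes G₀≈0 m i (ℕ.≤-<-trans i≤n n<m))) ⟩
    0# * (G ^^ m) (suc n) + (shift G ⊛ (λ _ → 0#)) n
      ≈⟨ +-cong (zeroˡ _) (trans (⊛-comm (shift G) (λ _ → 0#) n) (0-⊛ (shift G) (λ _ → refl) n)) ⟩
    0# + 0#
      ≈⟨ +-identityʳ 0# ⟩
    0# ∎

  sum-vanishes : ∀ n {t : Fin n → Carrier} → (∀ i → t i ≈ 0#) → sum t ≈ 0#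
  sum-vanishes n t≈0 = trans (sum-cong-≋ t≈0) (sum-replicate-zero n)

  sum-truncate : ∀ (t : ℕ → Carrier) {j n} → j ≤ n → (∀ m → j < m → t m ≈ 0#) →
                 ∑[ m ≤ n ] t (toℕ m) ≈ ∑[ m ≤ j ] t (toℕ m)
  sum-truncate t {n = n} z≤n t≈0 = +-congˡ (sum-vanishes n (λ m → t≈0 _ (s≤s z≤n)))
  sum-truncate t (s≤s j≤n) t≈0 = +-congˡ (sum-truncate (t ∘ suc) j≤n (λ m j<m → t≈0 (suc m) (s≤s j<m)))

  ⊛-sum : ∀ n (H : Series) (K : Fin n → Series) k →
          (H ⊛ λ j → ∑[ m < n ] K m j) k ≈ ∑[ m < n ] (H ⊛ K m) k
  ⊛-sum zero    H K k = trans (⊛-comm H (λ _ → 0#) k) (0-⊛ H (λ _ → refl) k)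
  ⊛-sum (suc n) H K k = begin
    (H ⊛ (K Fin.zero ⊕ λ j → ∑[ m < n ] K (Fin.suc m) j)) k
      ≈⟨ ⊛-distribˡ H (K Fin.zero) (λ j → ∑[ m < n ] K (Fin.suc m) j) k ⟩
    (H ⊛ K Fin.zero) k + (H ⊛ λ j → ∑[ m < n ] K (Fin.suc m) j) k
      ≈⟨ +-congˡ (⊛-sum n H (K ∘ Fin.suc) k) ⟩
    (H ⊛ K Fin.zero) k + (∑[ m < n ] (H ⊛ K (Fin.suc m)) k) ∎

  -- The derivative of G^(m+1)/(m+1)! is G' times G^m/m!, so differentiating the exponential sum
  -- only shifts its index. Coefficient j of `e^_` stops its sum at j, but G has no constant term,
  -- so the longer sum up to n gives the same value.
  D-e^ : ∀ F → D (e^ F) ≋ D F ⊛ (e^ F)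
  D-e^ F n = begin
    ⟦ suc n ⟧ * (exp (F 0) * ∑[ m ≤ suc n ] term (toℕ m) (suc n))
      ≈⟨ solve 3 (λ d c s → d :* (c :* s) := c :* (d :* s)) refl _ _ _ ⟩
    exp (F 0) * (⟦ suc n ⟧ * ∑[ m ≤ suc n ] term (toℕ m) (suc n))
      ≈⟨ *-congˡ (*-distribˡ-sum ⟦ suc n ⟧ (λ m → term (toℕ {suc (suc n)} m) (suc n))) ⟩
    -- The summand m = 0 is the constant series 1 and contributes nothing.
    exp (F 0) * (⟦ suc n ⟧ * ((1 over 0 !) * 0#) + ∑[ m ≤ n ] D (term (suc (toℕ m))) n)
      ≈⟨ *-congˡ (+-cong (trans (*-congˡ (zeroʳ _)) (zeroʳ _)) (sum-cong-≋ {suc n} (λ m → D-term (toℕ m)))) ⟩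
    exp (F 0) * (0# + ∑[ m ≤ n ] (D F ⊛ term (toℕ m)) n)
      ≈⟨ *-congˡ (+-identityˡ _) ⟩
    exp (F 0) * ∑[ m ≤ n ] (D F ⊛ term (toℕ m)) n
      ≈⟨ *-congˡ (⊛-sum (suc n) (D F) (term ∘ toℕ) n) ⟨
    exp (F 0) * (D F ⊛ (λ j → ∑[ m ≤ n ] term (toℕ m) j)) n
      ≈⟨ ⊛-scale (exp (F 0)) (D F) (λ j → ∑[ m ≤ n ] term (toℕ m) j) n ⟨
    (D F ⊛ (λ j → exp (F 0) * ∑[ m ≤ n ] term (toℕ m) j)) n
      -- Inside the convolution the bound n is lowered to j, since G^m vanishes at j when m > j.
      ≈⟨ ⊛-cong-≤ n {D F} (λ _ _ → refl) (λ j j≤n → *-congˡ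
           (sum-truncate (λ m → term m j) j≤n
             (λ m j<m → trans (*-congˡ (^^-vanishes (-‿inverseʳ (F 0)) m j j<m)) (zeroʳ _)))) ⟩
    (D F ⊛ (e^ F)) n ∎
    where
    G = F ⊖ constant (F 0)
    term : ℕ → Series
    term m = scale (1 over m !) (G ^^ m)

    D-term : ∀ m → D (term (suc m)) n ≈ (D F ⊛ term m) n
    D-term m = begin
      D (term (suc m)) n
        ≈⟨ D-scale (1 over suc m !) (G ^^ suc m) n ⟩
      (1 over suc m !) * D (G ^^ suc m) n
        ≈⟨ *-congˡ (D-^^ G m n) ⟩
      (1 over suc m !) * (⟦ suc m ⟧ * (D G ⊛ (G ^^ m)) n)
        ≈⟨ solve 3 (λ a d x → a :* (d :* x) := (d :* a) :* x) refl _ ⟦ suc m ⟧ _ ⟩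
      (⟦ suc m ⟧ * (1 over suc m !)) * (D G ⊛ (G ^^ m)) n
        ≈⟨ *-cong (⟦suc⟧-*-over 1 m) (⊛-congʳ (G ^^ m) (D-⊖-constant F (F 0)) n) ⟩
      (1 over m !) * (D F ⊛ (G ^^ m)) n
        ≈⟨ ⊛-scale (1 over m !) (D F) (G ^^ m) n ⟨
      (D F ⊛ term m) n ∎

  e^-0 : ∀ F → (e^ F) 0 ≈ exp (F 0)
  e^-0 F = begin
    exp (F 0) * ((1 over 0 !) * 1# + 0#)  ≈⟨ *-congˡ (+-congʳ (*-congʳ (over-0! 1))) ⟩
    exp (F 0) * ((1# + 0#) * 1# + 0#)     ≈⟨ solve 1 (λ x → x :* ((con 1 :+ con 0) :* con 1 :+ con 0) := x) refl _ ⟩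
    exp (F 0)                             ∎

  -- The product has derivative F' - F' times itself, hence zero, and so is constant by uniqueness
  -- for the equation Y' = 0. The constant is exp(F 0) exp(-F 0) = exp 0.
  e^⊛e^⊖ : ∀ F → (e^ F) ⊛ (e^ (⊖ F)) ≋ 𝟙
  e^⊛e^⊖ F = linear-ODE-unique (λ _ → 0#) (λ _ → 0#) derivative
    (λ n → trans (D-𝟙 n) (sym (trans (+-congʳ (0-⊛ 𝟙 (λ _ → refl) n)) (+-identityʳ _)))) (begin
    (e^ F) 0 * (e^ (⊖ F)) 0 + 0#   ≈⟨ +-identityʳ _ ⟩
    (e^ F) 0 * (e^ (⊖ F)) 0        ≈⟨ *-cong (e^-0 F) (e^-0 (⊖ F)) ⟩
    exp (F 0) * exp (- F 0)        ≈⟨ ExpHom.homo _ _ ⟨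
    exp (F 0 - F 0)                ≈⟨ ExpHom.⟦⟧-cong (-‿inverseʳ _) ⟩
    exp 0#                         ≈⟨ ExpHom.ε-homo ⟩
    1#                             ∎)
    where
    derivative : D ((e^ F) ⊛ (e^ (⊖ F))) ≋ (λ _ → 0#) ⊛ ((e^ F) ⊛ (e^ (⊖ F))) ⊕ (λ _ → 0#)
    derivative n = begin
      D ((e^ F) ⊛ (e^ (⊖ F))) n
        ≈⟨ D-⊛ (e^ F) (e^ (⊖ F)) n ⟩
      (D (e^ F) ⊛ (e^ (⊖ F))) n + ((e^ F) ⊛ D (e^ (⊖ F))) n
        ≈⟨ +-cong (⊛-congʳ (e^ (⊖ F)) (D-e^ F) n) (⊛-congˡ (e^ F) (D-e^ (⊖ F)) n) ⟩
      ((D F ⊛ (e^ F)) ⊛ (e^ (⊖ F))) n + ((e^ F) ⊛ (D (⊖ F) ⊛ (e^ (⊖ F)))) n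
        ≈⟨ +-cong (⊛-assoc (D F) (e^ F) (e^ (⊖ F)) n) (⊛-exchange (e^ F) (D (⊖ F)) (e^ (⊖ F)) n) ⟩
      x + (D (⊖ F) ⊛ ((e^ F) ⊛ (e^ (⊖ F)))) n
        ≈⟨ +-congˡ (⊛-congʳ ((e^ F) ⊛ (e^ (⊖ F))) (D-neg F) n) ⟩
      x + (scale (- 1#) (D F) ⊛ ((e^ F) ⊛ (e^ (⊖ F)))) n
        ≈⟨ +-congˡ (scale-⊛ (- 1#) (D F) ((e^ F) ⊛ (e^ (⊖ F))) n) ⟩
      x + - 1# * x
        ≈⟨ +-congˡ (-1*x≈-x x) ⟩
      x - x
        ≈⟨ -‿inverseʳ x ⟩
      0#
        ≈⟨ trans (+-congʳ (0-⊛ ((e^ F) ⊛ (e^ (⊖ F))) (λ _ → refl) n)) (+-identityʳ 0#) ⟨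
      ((λ _ → 0#) ⊛ ((e^ F) ⊛ (e^ (⊖ F)))) n + 0# ∎
      where x = (D F ⊛ ((e^ F) ⊛ (e^ (⊖ F)))) n

  e^X-0 : (e^ X) 0 ≈ 1#
  e^X-0 = trans (e^-0 X) ExpHom.ε-homo

  D-e^X : D (e^ X) ≋ e^ X
  D-e^X n = trans (D-e^ X n) (trans (⊛-congʳ (e^ X) D-X n) (𝟙-⊛ (e^ X) n))
    where
    D-X : D X ≋ 𝟙
    D-X zero    = solve 0 ((con 1 :+ con 0) :* con 1 := con 1) refl
    D-X (suc n) = zeroʳ _

  -- Exponential generating functions and their equations

  egf : (ℕ → ℕ) → Series
  egf f n = f n over n !

  D-egf : ∀ f → D (egf f) ≋ egf (f ∘ suc)
  D-egf f n = ⟦suc⟧-*-over (f (suc n)) n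

  ∫-solution : ∀ T → let Y = (e^ (e^ X)) ⊛ ∫₀ ((e^ (⊖ (e^ X))) ⊛ T) in
               D Y ≋ (e^ X) ⊛ Y ⊕ T
  ∫-solution T n = begin
    D (A ⊛ I) n
      ≈⟨ D-⊛ A I n ⟩
    (D A ⊛ I) n + (A ⊛ D I) n
      ≈⟨ +-cong (⊛-congʳ I D-A n) (⊛-congˡ A (D-∫₀ (B ⊛ T)) n) ⟩
    (((e^ X) ⊛ A) ⊛ I) n + (A ⊛ (B ⊛ T)) n
      ≈⟨ +-cong (⊛-assoc (e^ X) A I n) (sym (⊛-assoc A B T n)) ⟩
    ((e^ X) ⊛ (A ⊛ I)) n + ((A ⊛ B) ⊛ T) n
      ≈⟨ +-congˡ (trans (⊛-congʳ T (e^⊛e^⊖ (e^ X)) n) (𝟙-⊛ T n)) ⟩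
    ((e^ X) ⊛ (A ⊛ I)) n + T n ∎
    where
    A = e^ (e^ X)
    B = e^ (⊖ (e^ X))
    I = ∫₀ (B ⊛ T)
    D-A : D A ≋ (e^ X) ⊛ A
    D-A n = trans (D-e^ (e^ X) n) (⊛-congʳ A D-e^X n)

  -- Differentiating e^x F gives e^x F + e^x F', and F' has the shifted sequence. That is the
  -- recursion defining `binomialTransform`.
  e^X⊛egf : ∀ n f → ((e^ X) ⊛ egf f) n ≈ binomialTransform n f over n !
  e^X⊛egf zero    f = begin
    (e^ X) 0 * (f 0 over 0 !) + 0#  ≈⟨ +-identityʳ _ ⟩
    (e^ X) 0 * (f 0 over 0 !)       ≈⟨ *-congʳ e^X-0 ⟩
    1# * (f 0 over 0 !)             ≈⟨ *-identityˡ _ ⟩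
    f 0 over 0 !                    ∎
  e^X⊛egf (suc n) f =
    D-injective ((e^ X) ⊛ egf f) (egf (λ i → binomialTransform i f)) n (begin
      D ((e^ X) ⊛ egf f) n
        ≈⟨ D-⊛ (e^ X) (egf f) n ⟩
      (D (e^ X) ⊛ egf f) n + ((e^ X) ⊛ D (egf f)) n
        ≈⟨ +-cong (⊛-congʳ (egf f) D-e^X n) (⊛-congˡ (e^ X) (D-egf f) n) ⟩
      ((e^ X) ⊛ egf f) n + ((e^ X) ⊛ egf (f ∘ suc)) n
        ≈⟨ +-cong (e^X⊛egf n f) (e^X⊛egf n (f ∘ suc)) ⟩
      binomialTransform n f over n ! + binomialTransform n (f ∘ suc) over n !
        ≈⟨ over-+ (binomialTransform n f) (binomialTransform n (f ∘ suc)) n ⟨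
      binomialTransform (suc n) f over n !
        ≈⟨ D-egf (λ i → binomialTransform i f) n ⟨
      D (egf (λ i → binomialTransform i f)) n ∎)

  D-egf-recurrence : ∀ f t → (∀ n → f (suc n) ≡ binomialTransform n f ℕ.+ t n) →
                     D (egf f) ≋ (e^ X) ⊛ egf f ⊕ egf t
  D-egf-recurrence f t rec n = begin
    D (egf f) n                                    ≈⟨ D-egf f n ⟩
    f (suc n) over n !                             ≡⟨ ≡.cong (_over n !) (rec n) ⟩
    (binomialTransform n f ℕ.+ t n) over n !       ≈⟨ over-+ (binomialTransform n f) (t n) n ⟩
    binomialTransform n f over n ! + t n over n !  ≈⟨ +-congʳ (e^X⊛egf n f) ⟨
    ((e^ X) ⊛ egf f) n + t n over n !              ∎

  egf-1 : ∀ f → f 0 ≡ 1 → (∀ n → f (suc n) ≡ binomialTransform n f) →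
          egf f ≋ e^ ((e^ X) ⊖ 𝟙)
  egf-1 f f₀≡1 rec = linear-ODE-unique (e^ X) (egf (λ _ → 0))
    (D-egf-recurrence f (λ _ → 0) (λ n → ≡.trans (rec n) (≡.sym (ℕ.+-identityʳ _))))
    derivative
    (begin
      f 0 over 0 !              ≡⟨ ≡.cong (_over 0 !) f₀≡1 ⟩
      1 over 0 !                ≈⟨ over-0! 1 ⟩
      1# + 0#                   ≈⟨ +-identityʳ 1# ⟩
      1#                        ≈⟨ ExpHom.ε-homo ⟨
      -- The exponent e^x - 1 has no constant term.
      exp 0#                    ≈⟨ ExpHom.⟦⟧-cong (trans (+-congʳ e^X-0) (-‿inverseʳ 1#)) ⟨
      exp ((e^ X) 0 - 1#)       ≈⟨ e^-0 ((e^ X) ⊖ 𝟙) ⟨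
      (e^ ((e^ X) ⊖ 𝟙)) 0       ∎)
    where
    derivative : D (e^ ((e^ X) ⊖ 𝟙)) ≋ (e^ X) ⊛ (e^ ((e^ X) ⊖ 𝟙)) ⊕ egf (λ _ → 0)
    derivative n = begin
      D (e^ ((e^ X) ⊖ 𝟙)) n
        ≈⟨ D-e^ ((e^ X) ⊖ 𝟙) n ⟩
      (D ((e^ X) ⊖ 𝟙) ⊛ (e^ ((e^ X) ⊖ 𝟙))) n
        ≈⟨ ⊛-congʳ (e^ ((e^ X) ⊖ 𝟙)) (λ i → trans (D-⊖-constant (e^ X) 1# i) (D-e^X i)) n ⟩
      ((e^ X) ⊛ (e^ ((e^ X) ⊖ 𝟙))) n
        ≈⟨ trans (+-congˡ (0-over n)) (+-identityʳ _) ⟨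
      ((e^ X) ⊛ (e^ ((e^ X) ⊖ 𝟙))) n + 0 over n ! ∎

  egf-≥2 : ∀ m f → f 0 ≡ 0 →
           (∀ n → f (suc n) ≡ binomialTransform n f ℕ.+ (if m ≤ᵇ n then 1 else 0)) →
           egf f ≋ (e^ (e^ X)) ⊛ ∫₀ ((e^ (⊖ (e^ X))) ⊛ expTail m)
  egf-≥2 m f f₀≡0 rec = linear-ODE-unique (e^ X) (expTail m)
    (λ n → trans (D-egf-recurrence f (λ i → if m ≤ᵇ i then 1 else 0) rec n) (+-congˡ (egf-tail n)))
    (∫-solution (expTail m))
    (begin
      f 0 over 0 !               ≡⟨ ≡.cong (_over 0 !) f₀≡0 ⟩
      0 over 0 !                 ≈⟨ 0-over 0 ⟩
      0#                         ≈⟨ trans (+-identityʳ _) (zeroʳ _) ⟨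
      (e^ (e^ X)) 0 * 0# + 0#    ∎)
    where
    egf-tail : ∀ n → (if m ≤ᵇ n then 1 else 0) over n ! ≈ expTail m n
    egf-tail n with m ≤ᵇ n
    ... | true  = refl
    ... | false = 0-over n

open import Data.Nat.Base using (_+_)
open import Data.Nat.ListAction using (sum)
open import Data.Product.Base using (_×_)
open import Relation.Binary.PropositionalEquality using (refl; sym; trans)

-- Lists without repetitions

AllPairs-++⁻ : ∀ {a r} {A : Set a} {R : Rel A r} xs {ys} → AllPairs R (xs ++ ys) →
               AllPairs R xs × AllPairs R ys × All (λ x → All (R x) ys) xs
AllPairs-++⁻ []       ps       = [] , ps , []
AllPairs-++⁻ (x ∷ xs) (p ∷ ps) with AllPairs-++⁻ xs ps
... | pxs , pys , pxys = All.++⁻ˡ xs p ∷ pxs , pys , All.++⁻ʳ xs p ∷ pxys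

-- Duplicate-free lists with the same members are equal as bags, hence rearrangements of each other.
-- The recurrences are counted in this way.
unique-length : ∀ {a} {A : Set a} {xs ys : List A} → Unique xs → Unique ys →
                (∀ z → z ∈ xs ⇔ z ∈ ys) → length xs ≡ length ys
unique-length uxs uys eq = ↭-length (∼bag⇒↭ (unique∧set⇒bag uxs uys (eq _)))

lookup-injective : ∀ {a} {A : Set a} {xs : List A} → Unique xs →
                   ∀ {i j} → List.lookup xs i ≡ List.lookup xs j → i ≡ j
lookup-injective (_ ∷ _)  {Fin.zero}  {Fin.zero}  _  = refl
lookup-injective (p ∷ _)  {Fin.zero}  {Fin.suc j} eq = contradiction eq (All.lookup p (∈-lookup j))
lookup-injective (p ∷ _)  {Fin.suc i} {Fin.zero}  eq = contradiction (sym eq) (All.lookup p (∈-lookup i))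
lookup-injective (_ ∷ u)  {Fin.suc i} {Fin.suc j} eq = cong Fin.suc (lookup-injective u eq)

-- Pigeonhole: the positions of `w` inject into the letters below n.
unique-length-≤ : ∀ {n w} → Unique w → All (_< n) w → length w ≤ n
unique-length-≤ {w = w} u w<n = Fin.injective⇒≤ {f = λ i → Fin.fromℕ< (bound i)} λ eq →
  lookup-injective u (trans (sym (Fin.toℕ-fromℕ< (bound _))) (trans (cong Fin.toℕ eq) (Fin.toℕ-fromℕ< (bound _))))
  where
  bound : ∀ i → List.lookup w i < _
  bound i = All.lookup w<n (∈-lookup i)

map-suc-∈ : ∀ {j v} → suc j ∈ map suc v → j ∈ v
map-suc-∈ j∈ with ∈-map⁻ suc j∈
... | _ , j∈v , refl = j∈v

unmap-suc : ∀ {w} → All (0 <_) w → ∃ λ w′ → map suc w′ ≡ w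
unmap-suc []            = [] , refl
unmap-suc (z<s {i} ∷ p) with unmap-suc p
... | w′ , refl = i ∷ w′ , refl

map-suc-positive : ∀ w → All (0 <_) (map suc w)
map-suc-positive w = All.map⁺ (All.universal (λ _ → z<s) w)

unmap : ∀ (f : ℕ → ℕ) {w} → All (λ y → ∃ λ x → f x ≡ y) w → ∃ λ w′ → map f w′ ≡ w
unmap f []                = [] , refl
unmap f ((x , refl) ∷ ps) with unmap f ps
... | w′ , refl = x ∷ w′ , refl

-- Avoidance of 1-32

-- The adjacent 32 of an occurrence of 1-32 whose 1 is `x`.
data DescentAbove (x : ℕ) : List ℕ → Set where
  here  : ∀ {y z w} → x < z → z < y → DescentAbove x (y ∷ z ∷ w)
  there : ∀ {y w} → DescentAbove x w → DescentAbove x (y ∷ w)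

data Contains : List ℕ → Set where
  here  : ∀ {x w} → DescentAbove x w → Contains (x ∷ w)
  there : ∀ {x w} → Contains w → Contains (x ∷ w)

descentAbove-++⁺ˡ : ∀ {x u v} → DescentAbove x u → DescentAbove x (u ++ v)
descentAbove-++⁺ˡ (here x<z z<y) = here x<z z<y
descentAbove-++⁺ˡ (there d)      = there (descentAbove-++⁺ˡ d)

contains-++⁺ˡ : ∀ {u v} → Contains u → Contains (u ++ v)
contains-++⁺ˡ (here d)  = here (descentAbove-++⁺ˡ d)
contains-++⁺ˡ (there c) = there (contains-++⁺ˡ c)

contains-++⁺ʳ : ∀ u {v} → Contains v → Contains (u ++ v)
contains-++⁺ʳ []      c = c
contains-++⁺ʳ (_ ∷ u) c = there (contains-++⁺ʳ u c)

increasing⇒¬descentAbove : ∀ {x v} → AllPairs _<_ v → ¬ DescentAbove x v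
increasing⇒¬descentAbove ((y<z ∷ _) ∷ _) (here _ z<y) = ℕ.<-asym y<z z<y
increasing⇒¬descentAbove (_ ∷ inc)       (there d)    = increasing⇒¬descentAbove inc d

increasing⇒¬contains : ∀ {v} → AllPairs _<_ v → ¬ Contains v
increasing⇒¬contains (_ ∷ inc) (here d)  = increasing⇒¬descentAbove inc d
increasing⇒¬contains (_ ∷ inc) (there c) = increasing⇒¬contains inc c

-- With `x` below everything, each adjacent pair that fails to ascend would be a forbidden descent.
-- It is applied with `x` the letter 0.
¬descentAbove⇒increasing : ∀ {x v} → ¬ DescentAbove x v → All (x <_) v → Unique v → AllPairs _<_ v
¬descentAbove⇒increasing nd x<v u = Linked.Linked⇒AllPairs ℕ.<-trans (linked _ nd x<v u)
  where
  linked : ∀ {x} v → ¬ DescentAbove x v → All (x <_) v → Unique v → Linked _<_ v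
  linked []          _  _               _                 = []
  linked (y ∷ [])    _  _               _                 = [-]
  linked (y ∷ z ∷ v) nd (_ ∷ x<z ∷ x<v) ((y≢z ∷ _) ∷ u) with <-cmp y z
  ... | tri< y<z _ _ = y<z ∷ linked (z ∷ v) (nd ∘ there) (x<z ∷ x<v) u
  ... | tri≈ _ y≡z _ = contradiction y≡z y≢z
  ... | tri> _ _ z<y = contradiction (here x<z z<y) nd

-- The one new descent ends in 0, which exceeds no `x`.
¬descentAbove-++-0 : ∀ {x} u {v} → ¬ DescentAbove x u → AllPairs _<_ v → ¬ DescentAbove x (u ++ 0 ∷ v)
¬descentAbove-++-0 []          nd inc (there d)      = increasing⇒¬descentAbove inc d
¬descentAbove-++-0 (_ ∷ [])    nd inc (there d)      = ¬descentAbove-++-0 [] (λ ()) inc d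
¬descentAbove-++-0 (_ ∷ _ ∷ u) nd inc (here x<z z<y) = nd (here x<z z<y)
¬descentAbove-++-0 (_ ∷ _ ∷ u) nd inc (there d)      = ¬descentAbove-++-0 (_ ∷ u) (nd ∘ there) inc d

¬contains-++-0 : ∀ u {v} → ¬ Contains u → AllPairs _<_ v → ¬ Contains (u ++ 0 ∷ v)
¬contains-++-0 []      _  inc (here d)  = increasing⇒¬descentAbove inc d
¬contains-++-0 []      _  inc (there c) = increasing⇒¬contains inc c
¬contains-++-0 (_ ∷ u) nc inc (here d)  = ¬descentAbove-++-0 u (nc ∘ here) inc d
¬contains-++-0 (_ ∷ u) nc inc (there c) = ¬contains-++-0 u (nc ∘ there) inc c

-- Initial segments of shape (k-1)⋯1k

-- `Begin m h y w` reads m decreasing letters, the first below `h`, and then `y`. The bound is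
-- replaced by each letter read; m is k-1.
data Begin : ℕ → ℕ → ℕ → List ℕ → Set where
  last : ∀ {h y w} → Begin 0 h y (y ∷ w)
  _∷_  : ∀ {m h x y w} → x < h → Begin m x y w → Begin (suc m) h y (x ∷ w)

-- For h = y this is the pattern m⋯1(m+1), as the m decreasing letters then
-- lie below the letter y after them.
Begins : ℕ → List ℕ → Set
Begins m w = ∃ λ y → Begin m y y w

begin-++⁺ˡ : ∀ {m h y u v} → Begin m h y u → Begin m h y (u ++ v)
begin-++⁺ˡ last      = last
begin-++⁺ˡ (x<h ∷ b) = x<h ∷ begin-++⁺ˡ b

begin-length : ∀ {m h y w} → Begin m h y w → m < length w
begin-length last    = z<s
begin-length (_ ∷ b) = s<s (begin-length b)

begin-∈ : ∀ {m h y w} → Begin m h y w → y ∈ w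
begin-∈ last    = here refl
begin-∈ (_ ∷ b) = there (begin-∈ b)

-- The decreasing run cannot continue below 0, so an initial segment that is not contained in `u`
-- has 0 as the last letter of its run and `y` right after it. That `y` is positive excludes 0 from
-- being `y` itself.
begin-++-0 : ∀ {m h y} u {v} → 0 < y → Begin m h y (u ++ 0 ∷ v) →
             Begin m h y u ⊎
             (AllPairs _>_ (u ++ [ 0 ]) × All (h >_) (u ++ [ 0 ]) ×
              m ≡ length (u ++ [ 0 ]) × ∃ λ v′ → v ≡ y ∷ v′)
begin-++-0 []      0<y (0<h ∷ last)     = inj₂ ([] ∷ [] , 0<h ∷ [] , refl , _ , refl)
begin-++-0 (x ∷ u) 0<y last             = inj₁ last
begin-++-0 (x ∷ u) 0<y (x<h ∷ b) with begin-++-0 u 0<y b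
... | inj₁ b′                   = inj₁ (x<h ∷ b′)
... | inj₂ (dec , x> , eq , v≡) =
  inj₂ (x> ∷ dec , x<h ∷ All.map (λ i<x → ℕ.<-trans i<x x<h) x> , cong suc eq , v≡)

-- Strictly increasing relabellings

module Relabel (f : ℕ → ℕ) (f-mono : ∀ {x y} → x < y → f x < f y) where

  f-reflects-< : ∀ {x y} → f x < f y → x < y
  f-reflects-< {x} {y} fx<fy with <-cmp x y
  ... | tri< x<y _ _  = x<y
  ... | tri≈ _ refl _ = contradiction fx<fy (ℕ.<-irrefl refl)
  ... | tri> _ _ y<x  = contradiction (f-mono y<x) (ℕ.<-asym fx<fy)

  f-injective : ∀ {x y} → f x ≡ f y → x ≡ y
  f-injective {x} {y} fx≡fy with <-cmp x y
  ... | tri< x<y _ _  = contradiction (f-mono x<y) (ℕ.<-irrefl fx≡fy)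
  ... | tri≈ _ x≡y _  = x≡y
  ... | tri> _ _ y<x  = contradiction (f-mono y<x) (ℕ.<-irrefl (sym fx≡fy))

  descentAbove-map⁺ : ∀ {x w} → DescentAbove x w → DescentAbove (f x) (map f w)
  descentAbove-map⁺ (here x<z z<y) = here (f-mono x<z) (f-mono z<y)
  descentAbove-map⁺ (there d)      = there (descentAbove-map⁺ d)

  descentAbove-map⁻ : ∀ {x} w → DescentAbove (f x) (map f w) → DescentAbove x w
  descentAbove-map⁻ (_ ∷ [])    (there d)      = there (descentAbove-map⁻ [] d)
  descentAbove-map⁻ (_ ∷ _ ∷ _) (here x<z z<y) = here (f-reflects-< x<z) (f-reflects-< z<y)
  descentAbove-map⁻ (_ ∷ _ ∷ w) (there d)      = there (descentAbove-map⁻ (_ ∷ w) d)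

  contains-map⁺ : ∀ {w} → Contains w → Contains (map f w)
  contains-map⁺ (here d)  = here (descentAbove-map⁺ d)
  contains-map⁺ (there c) = there (contains-map⁺ c)

  contains-map⁻ : ∀ w → Contains (map f w) → Contains w
  contains-map⁻ (_ ∷ w) (here d)  = here (descentAbove-map⁻ w d)
  contains-map⁻ (_ ∷ w) (there c) = there (contains-map⁻ w c)

  begin-map⁺ : ∀ {m h y w} → Begin m h y w → Begin m (f h) (f y) (map f w)
  begin-map⁺ last      = last
  begin-map⁺ (x<h ∷ b) = f-mono x<h ∷ begin-map⁺ b

  begin-map⁻ : ∀ {m h y} w → Begin m (f h) (f y) (map f w) → Begin m h y w
  begin-map⁻ {zero} (x ∷ w) b = start b refl
    where
    start : ∀ {h′ h y′ y} → Begin 0 h′ y′ (f x ∷ map f w) → y′ ≡ f y → Begin 0 h y (x ∷ w)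
    start last eq with f-injective eq
    ... | refl = last
  begin-map⁻ (x ∷ w) (x<h ∷ b) = f-reflects-< x<h ∷ begin-map⁻ w b

  begins-map⁻ : ∀ {m} w → Begins m (map f w) → Begins m w
  begins-map⁻ w (_ , b) with ∈-map⁻ f (begin-∈ b)
  ... | y , _ , refl = y , begin-map⁻ w b

-- Removing the last block

-- A subset of {0,...,n-1} by its characteristic vector.
Choice : ℕ → Set
Choice = Vec Bool

ones : ∀ {n} → Choice n → List ℕ
ones Vec.[]            = []
ones (false Vec.∷ s) = map suc (ones s)
ones (true  Vec.∷ s) = 0 ∷ map suc (ones s)

zeros : ∀ {n} → Choice n → ℕ
zeros Vec.[]            = 0
zeros (false Vec.∷ s) = suc (zeros s)
zeros (true  Vec.∷ s) = zeros s

-- The increasing enumeration of the positions of the false entries, continued past the end.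
skip : ∀ {n} → Choice n → ℕ → ℕ
skip Vec.[]          x       = x
skip (false Vec.∷ s) zero    = zero
skip (false Vec.∷ s) (suc x) = suc (skip s x)
skip (true  Vec.∷ s) x       = suc (skip s x)

increasing-map-suc : ∀ {v} → AllPairs _<_ v → AllPairs _<_ (map suc v)
increasing-map-suc inc = AllPairs.map⁺ (AllPairs.map s<s inc)

increasing-ones : ∀ {n} (s : Choice n) → AllPairs _<_ (ones s)
increasing-ones Vec.[]          = []
increasing-ones (false Vec.∷ s) = increasing-map-suc (increasing-ones s)
increasing-ones (true  Vec.∷ s) = map-suc-positive (ones s) ∷ increasing-map-suc (increasing-ones s)

ones-< : ∀ {n} (s : Choice n) → All (_< n) (ones s)
ones-< Vec.[]          = []
ones-< (false Vec.∷ s) = All.map⁺ (All.map s<s (ones-< s))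
ones-< (true  Vec.∷ s) = z<s ∷ All.map⁺ (All.map s<s (ones-< s))

zeros+ones : ∀ {n} (s : Choice n) → zeros s + length (ones s) ≡ n
zeros+ones Vec.[]          = refl
zeros+ones (false Vec.∷ s) =
  cong suc (trans (cong (zeros s ℕ.+_) (List.length-map suc (ones s))) (zeros+ones s))
zeros+ones (true  Vec.∷ s) =
  trans (ℕ.+-suc (zeros s) _)
    (cong suc (trans (cong (zeros s ℕ.+_) (List.length-map suc (ones s))) (zeros+ones s)))

skip-mono-< : ∀ {n} (s : Choice n) {x y} → x < y → skip s x < skip s y
skip-mono-< Vec.[]                            x<y = x<y
skip-mono-< (false Vec.∷ s) {zero}  {suc y} x<y = z<s
skip-mono-< (false Vec.∷ s) {suc x} {suc y} x<y = s<s (skip-mono-< s (s<s⁻¹ x<y))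
skip-mono-< (true  Vec.∷ s)                 x<y = s<s (skip-mono-< s x<y)

skip-< : ∀ {n} (s : Choice n) {x} → x < zeros s → skip s x < n
skip-< (false Vec.∷ s) {zero}  _       = z<s
skip-< (false Vec.∷ s) {suc x} x<zeros = s<s (skip-< s (s<s⁻¹ x<zeros))
skip-< (true  Vec.∷ s)         x<zeros = s<s (skip-< s x<zeros)

skip-<⁻ : ∀ {n} (s : Choice n) {x} → skip s x < n → x < zeros s
skip-<⁻ (false Vec.∷ s) {zero}  _      = z<s
skip-<⁻ (false Vec.∷ s) {suc x} skip<n = s<s (skip-<⁻ s (s<s⁻¹ skip<n))
skip-<⁻ (true  Vec.∷ s)         skip<n = skip-<⁻ s (s<s⁻¹ skip<n)

skip-∉-ones : ∀ {n} (s : Choice n) x → skip s x ∉ ones s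
skip-∉-ones (false Vec.∷ s) zero    0∈ with ∈-map⁻ suc 0∈
... | _ , _ , ()
skip-∉-ones (false Vec.∷ s) (suc x) ∈ones         = skip-∉-ones s x (map-suc-∈ ∈ones)
skip-∉-ones (true  Vec.∷ s) x       (there ∈ones) = skip-∉-ones s x (map-suc-∈ ∈ones)

∉-ones⇒skip : ∀ {n} (s : Choice n) j → j ∉ ones s → ∃ λ x → skip s x ≡ j
∉-ones⇒skip Vec.[]          j       _   = j , refl
∉-ones⇒skip (false Vec.∷ s) zero    _   = zero , refl
∉-ones⇒skip (false Vec.∷ s) (suc j) j∉ with ∉-ones⇒skip s j (j∉ ∘ ∈-map⁺ suc)
... | x , refl = suc x , refl
∉-ones⇒skip (true  Vec.∷ s) zero    0∉  = contradiction (here refl) 0∉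
∉-ones⇒skip (true  Vec.∷ s) (suc j) j∉ with ∉-ones⇒skip s j (j∉ ∘ there ∘ ∈-map⁺ suc)
... | x , refl = x , refl

ones-injective : ∀ {n} (s t : Choice n) → ones s ≡ ones t → s ≡ t
ones-injective Vec.[]          Vec.[]          _  = refl
ones-injective (false Vec.∷ s) (false Vec.∷ t) eq =
  cong (false Vec.∷_) (ones-injective s t (List.map-injective ℕ.suc-injective eq))
ones-injective (true  Vec.∷ s) (true  Vec.∷ t) eq =
  cong (true Vec.∷_) (ones-injective s t (List.map-injective ℕ.suc-injective (List.∷-injectiveʳ eq)))
ones-injective (false Vec.∷ s) (true  Vec.∷ t) eq with ones s
ones-injective (false Vec.∷ s) (true  Vec.∷ t) () | []
ones-injective (false Vec.∷ s) (true  Vec.∷ t) () | _ ∷ _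
ones-injective (true  Vec.∷ s) (false Vec.∷ t) eq with ones t
ones-injective (true  Vec.∷ s) (false Vec.∷ t) () | []
ones-injective (true  Vec.∷ s) (false Vec.∷ t) () | _ ∷ _

ones-surjective : ∀ n {v} → AllPairs _<_ v → All (_< n) v → ∃ λ (s : Choice n) → ones s ≡ v
ones-surjective-suc : ∀ n {v} → All (0 <_) v → AllPairs _<_ v → All (_< suc n) v →
                      ∃ λ (s : Choice n) → map suc (ones s) ≡ v

ones-surjective zero    []            []       = Vec.[] , refl
ones-surjective (suc n) []            []       with ones-surjective n [] []
... | s , eq = false Vec.∷ s , cong (map suc) eq
ones-surjective (suc n) {zero ∷ v}  (0<v ∷ inc) (_ ∷ v<n) with ones-surjective-suc n 0<v inc v<n
... | s , refl = true Vec.∷ s , refl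
ones-surjective (suc n) {suc x ∷ v} (x<v ∷ inc) v<n
  with ones-surjective-suc n (z<s ∷ All.map (ℕ.<-trans z<s) x<v) (x<v ∷ inc) v<n
... | s , eq = false Vec.∷ s , eq

ones-surjective-suc n 0<v inc v<n with unmap-suc 0<v
... | v , refl with ones-surjective n (AllPairs.map s<s⁻¹ (AllPairs.map⁻ inc)) (All.map s<s⁻¹ (All.map⁻ v<n))
...   | s , refl = s , refl

record IsPerm (n : ℕ) (w : List ℕ) : Set where
  constructor isPerm
  field
    has-length : length w ≡ n
    bounded    : All (_< n) w
    distinct   : Unique w

-- The choice s marks those of the letters 1,…,n that follow the letter 0.
attach : ∀ {n} → Choice n → List ℕ → List ℕ
attach s w = map (suc ∘ skip s) w ++ 0 ∷ map suc (ones s)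

-- Since `skip` continues past the end of the choice, it increases strictly on all of ℕ, as
-- `Relabel` requires.
module SkipRelabel {n} (s : Choice n) = Relabel (suc ∘ skip s) (s<s ∘ skip-mono-< s)

increasing⇒unique : ∀ {v} → AllPairs _<_ v → Unique v
increasing⇒unique = AllPairs.map ℕ.<⇒≢

length-attach : ∀ {n} (s : Choice n) w → length (attach s w) ≡ suc (length w + length (ones s))
length-attach s w = begin
  length (attach s w)
    ≡⟨ List.length-++ (map (suc ∘ skip s) w) ⟩
  length (map (suc ∘ skip s) w) + suc (length (map suc (ones s)))
    ≡⟨ cong₂ (λ a b → a + suc b) (List.length-map _ w) (List.length-map suc (ones s)) ⟩
  length w + suc (length (ones s))
    ≡⟨ ℕ.+-suc (length w) _ ⟩
  suc (length w + length (ones s)) ∎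
  where open ≡.≡-Reasoning

attach-isPerm : ∀ {n} (s : Choice n) {w} → IsPerm (zeros s) w → IsPerm (suc n) (attach s w)
attach-isPerm {n} s {w} (isPerm len w<k uniq) = isPerm
  (trans (length-attach s w) (cong suc (trans (cong (_+ length (ones s)) len) (zeros+ones s))))
  (All.++⁺ (All.map⁺ (All.map (s<s ∘ skip-< s) w<k)) (z<s ∷ All.map⁺ (All.map s<s (ones-< s))))
  (Unique.++⁺ (Unique.map⁺ (SkipRelabel.f-injective s) uniq)
    (All.map ℕ.<⇒≢ (map-suc-positive (ones s)) ∷
      Unique.map⁺ ℕ.suc-injective (increasing⇒unique (increasing-ones s)))
    disjoint)
  where
  disjoint : Disjoint (map (suc ∘ skip s) w) (0 ∷ map suc (ones s))
  disjoint (z∈ , z∈′) with ∈-map⁻ (suc ∘ skip s) z∈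
  disjoint (z∈ , there z∈′) | x , _ , refl = skip-∉-ones s x (map-suc-∈ z∈′)

attach-avoids : ∀ {n} (s : Choice n) w → ¬ Contains w → ¬ Contains (attach s w)
attach-avoids s w nc = ¬contains-++-0 (map (suc ∘ skip s) w) (nc ∘ SkipRelabel.contains-map⁻ s w)
  (increasing-map-suc (increasing-ones s))

-- Positivity of the prefixes makes the displayed 0 the first one on both sides. Hence both
-- ingredients of `attach` can be read off the result.
split-0-unique : ∀ {u u′ v v′} → All (0 <_) u → All (0 <_) u′ → u ++ 0 ∷ v ≡ u′ ++ 0 ∷ v′ →
                 u ≡ u′ × v ≡ v′
split-0-unique []        []        refl = refl , refl
split-0-unique []        (() ∷ _)  refl
split-0-unique (() ∷ _)  []        refl
split-0-unique (_ ∷ 0<u) (_ ∷ 0<u′) eq with List.∷-injective eq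
... | refl , eq′ with split-0-unique 0<u 0<u′ eq′
...   | refl , refl = refl , refl

map-suc∘-positive : ∀ (f : ℕ → ℕ) w → All (0 <_) (map (suc ∘ f) w)
map-suc∘-positive f w = All.map⁺ (All.universal (λ _ → z<s) w)

attach-injective : ∀ {n} (s t : Choice n) {v w} → attach s v ≡ attach t w → s ≡ t × v ≡ w
attach-injective s t {v} {w} eq
  with split-0-unique (map-suc∘-positive (skip s) v) (map-suc∘-positive (skip t) w) eq
... | eqˡ , eqʳ with ones-injective s t (List.map-injective ℕ.suc-injective eqʳ)
...   | refl = refl , List.map-injective (SkipRelabel.f-injective s) eqˡ

-- Without the letter 0, lowering all letters by one would give n+1 distinct letters below n.
0∈perm : ∀ {n w} → IsPerm (suc n) w → 0 ∈ w
0∈perm {n} {w} (isPerm len w<n uniq) with 0 ∈? w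
  where open DecMembership ℕ._≟_
... | yes 0∈w = 0∈w
... | no  0∉w with unmap-suc (All.tabulate (λ {x} x∈w → ℕ.n≢0⇒n>0 (λ { refl → 0∉w x∈w })))
...   | w′ , refl = contradiction
  (unique-length-≤ (Unique.map⁻ uniq) (All.map s<s⁻¹ (All.map⁻ w<n)))
  (ℕ.<⇒≱ (ℕ.≤-reflexive (sym (trans (sym (List.length-map suc w′)) len))))

attach-isPerm⁻ : ∀ {n} (s : Choice n) {w} → IsPerm (suc n) (attach s w) → IsPerm (zeros s) w
attach-isPerm⁻ s {w} (isPerm len w<n uniq) = isPerm
  (ℕ.+-cancelʳ-≡ (length (ones s)) _ _
    (ℕ.suc-injective (trans (sym (length-attach s w)) (trans len (cong suc (sym (zeros+ones s)))))))
  (All.map (skip-<⁻ s ∘ s<s⁻¹) (All.map⁻ (All.++⁻ˡ _ w<n)))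
  (Unique.map⁻ (proj₁ (AllPairs-++⁻ (map (suc ∘ skip s) w) uniq)))

-- A descent in `v` would form a 1-32 with the preceding 0, so `v` increases and is determined by
-- its set of letters.
detach-choice : ∀ {n} u {v} → IsPerm (suc n) (u ++ 0 ∷ v) → ¬ Contains (u ++ 0 ∷ v) →
                ∃ λ (s : Choice n) → map suc (ones s) ≡ v
detach-choice u (isPerm _ bound uniq) nc with AllPairs-++⁻ u uniq
... | _ , 0≢v ∷ uniqᵛ , _ = ones-surjective-suc _ 0<v
  (¬descentAbove⇒increasing (nc ∘ contains-++⁺ʳ u ∘ here) 0<v uniqᵛ)
  (All.tail (All.++⁻ʳ u bound))
  where 0<v = All.map (λ 0≢x → ℕ.n≢0⇒n>0 (0≢x ∘ sym)) 0≢v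

-- The letters before 0 are neither 0 nor marked by `s`, and exactly such letters are values of
-- `suc ∘ skip s`.
detach-word : ∀ {n} (s : Choice n) u → Unique (u ++ 0 ∷ map suc (ones s)) →
              ∃ λ w → map (suc ∘ skip s) w ≡ u
detach-word s u uniq with AllPairs-++⁻ u uniq
... | _ , _ , u≢ = unmap (suc ∘ skip s) (All.map preimage u≢)
  where
  preimage : ∀ {j} → All (j ≢_) (0 ∷ map suc (ones s)) → ∃ λ x → suc (skip s x) ≡ j
  preimage {zero}  (0≢0 ∷ _) = contradiction refl 0≢0
  preimage {suc j} (_ ∷ j≢) with ∉-ones⇒skip s j (λ j∈ → All.lookup j≢ (∈-map⁺ suc j∈) refl)
  ... | x , eq = x , cong suc eq

detach : ∀ {n w} → IsPerm (suc n) w → ¬ Contains w →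
         ∃₂ λ (s : Choice n) w′ → w ≡ attach s w′ × IsPerm (zeros s) w′ × ¬ Contains w′
detach perm nc with ∈-∃++ (0∈perm perm)
... | u , v , refl with detach-choice u perm nc
...   | s , refl with detach-word s u (IsPerm.distinct perm)
...     | w′ , refl =
  s , w′ , refl , attach-isPerm⁻ s perm , nc ∘ contains-++⁺ˡ ∘ SkipRelabel.contains-map⁺ s

-- Counting by the choice of the last block

choices : ∀ n → List (Choice n)
choices zero    = [ Vec.[] ]
choices (suc n) = map (true Vec.∷_) (choices n) ++ map (false Vec.∷_) (choices n)

∈-choices : ∀ {n} (s : Choice n) → s ∈ choices n
∈-choices Vec.[]          = here refl
∈-choices (true  Vec.∷ s) = ∈-++⁺ˡ (∈-map⁺ (true Vec.∷_) (∈-choices s))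
∈-choices (false Vec.∷ s) = ∈-++⁺ʳ _ (∈-map⁺ (false Vec.∷_) (∈-choices s))

choices-unique : ∀ n → Unique (choices n)
choices-unique zero    = [] ∷ []
choices-unique (suc n) = Unique.++⁺
  (Unique.map⁺ Vec.∷-injectiveʳ (choices-unique n))
  (Unique.map⁺ Vec.∷-injectiveʳ (choices-unique n))
  disjoint
  where
  disjoint : Disjoint (map (true Vec.∷_) (choices n)) (map (false Vec.∷_) (choices n))
  disjoint (z∈ , z∈′) with ∈-map⁻ (true Vec.∷_) z∈ | ∈-map⁻ (false Vec.∷_) z∈′
  ... | _ , _ , refl | _ , _ , ()

-- Sorting subsets by their first entry is Pascal's rule: `true` keeps `zeros`, `false` raises it by
-- one.
sum-choices : ∀ n f → sum (map (f ∘ zeros) (choices n)) ≡ binomialTransform n f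
sum-choices zero    f = ℕ.+-identityʳ (f 0)
sum-choices (suc n) f = begin
  sum (map (f ∘ zeros) (map (true Vec.∷_) cs ++ map (false Vec.∷_) cs))
    ≡⟨ cong sum (List.map-++ (f ∘ zeros) (map (true Vec.∷_) cs) _) ⟩
  sum (map (f ∘ zeros) (map (true Vec.∷_) cs) ++ map (f ∘ zeros) (map (false Vec.∷_) cs))
    ≡⟨ sum-++ (map (f ∘ zeros) (map (true Vec.∷_) cs)) _ ⟩
  sum (map (f ∘ zeros) (map (true Vec.∷_) cs)) + sum (map (f ∘ zeros) (map (false Vec.∷_) cs))
    ≡⟨ cong₂ (λ a b → sum a + sum b) (List.map-∘ cs) (List.map-∘ cs) ⟨
  sum (map (f ∘ zeros) cs) + sum (map (f ∘ suc ∘ zeros) cs)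
    ≡⟨ cong₂ _+_ (sum-choices n f) (sum-choices n (f ∘ suc)) ⟩
  binomialTransform (suc n) f ∎
  where
  open ≡.≡-Reasoning
  cs = choices n

length-concatMap : ∀ {a b} {A : Set a} {B : Set b} (g : A → List B) xs →
                   length (concatMap g xs) ≡ sum (map (length ∘ g) xs)
length-concatMap g []       = refl
length-concatMap g (x ∷ xs) = trans (List.length-++ (g x)) (cong (length (g x) ℕ.+_) (length-concatMap g xs))

blocks : (ℕ → List (List ℕ)) → ℕ → List (List ℕ)
blocks M n = concatMap (λ s → map (attach s) (M (zeros s))) (choices n)

length-blocks : ∀ M n → length (blocks M n) ≡ binomialTransform n (length ∘ M)
length-blocks M n = begin
  length (blocks M n)
    ≡⟨ length-concatMap (λ s → map (attach s) (M (zeros s))) (choices n) ⟩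
  sum (map (λ s → length (map (attach s) (M (zeros s)))) (choices n))
    ≡⟨ cong sum (List.map-cong (λ s → List.length-map (attach s) (M (zeros s))) (choices n)) ⟩
  sum (map (length ∘ M ∘ zeros) (choices n))
    ≡⟨ sum-choices n (length ∘ M) ⟩
  binomialTransform n (length ∘ M) ∎
  where open ≡.≡-Reasoning

blocks-unique : ∀ {M} → (∀ n → Unique (M n)) → ∀ n → Unique (blocks M n)
blocks-unique {M} uniq n = Unique.concat⁺
  (All.map⁺ (All.universal (λ s → Unique.map⁺ (proj₂ ∘ attach-injective s s) (uniq (zeros s))) (choices n)))
  (AllPairs.map⁺ (AllPairs.map disjoint (choices-unique n)))
  where
  disjoint : ∀ {s t} → s ≢ t → Disjoint (map (attach s) (M (zeros s))) (map (attach t) (M (zeros t)))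
  disjoint {s} {t} s≢t (w∈ , w∈′) with ∈-map⁻ (attach s) w∈ | ∈-map⁻ (attach t) w∈′
  ... | _ , _ , refl | _ , _ , eq = s≢t (proj₁ (attach-injective s t eq))

∈-blocks⁺ : ∀ {M n} (s : Choice n) {w} → w ∈ M (zeros s) → attach s w ∈ blocks M n
∈-blocks⁺ {M} s w∈ = ∈-concat⁺′ (∈-map⁺ (attach s) w∈)
  (∈-map⁺ (λ s → map (attach s) (M (zeros s))) (∈-choices s))

∈-blocks⁻ : ∀ {M n w} → w ∈ blocks M n → ∃₂ λ (s : Choice n) w′ → w ≡ attach s w′ × w′ ∈ M (zeros s)
∈-blocks⁻ {M} {n} w∈ with ∈-concat⁻′ (map (λ s → map (attach s) (M (zeros s))) (choices n)) w∈
... | _ , w∈′ , ws∈ with ∈-map⁻ (λ s → map (attach s) (M (zeros s))) ws∈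
...   | s , _ , refl with ∈-map⁻ (attach s) w∈′
...     | w′ , w′∈ , eq = s , w′ , eq , w′∈

Enumerates : (ℕ → List (List ℕ)) → (ℕ → List ℕ → Set) → Set
Enumerates M P = (∀ n → Unique (M n)) × (∀ n w → w ∈ M n ⇔ P n w)

avoider-recurrence : ∀ {M} → Enumerates M (λ n w → IsPerm n w × ¬ Contains w) →
                     ∀ n → length (M (suc n)) ≡ binomialTransform n (length ∘ M)
avoider-recurrence {M} (uniq , enum) n =
  trans (unique-length (uniq (suc n)) (blocks-unique uniq n) (λ w → mk⇔ (to w) (from w)))
        (length-blocks M n)
  where
  to : ∀ w → w ∈ M (suc n) → w ∈ blocks M n
  to w w∈ with Equivalence.to (enum (suc n) w) w∈
  ... | perm , nc with detach perm nc
  ...   | s , w′ , eq , perm′ , nc′ =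
    subst (_∈ blocks M n) (sym eq) (∈-blocks⁺ {M} s (Equivalence.from (enum _ w′) (perm′ , nc′)))

  from : ∀ w → w ∈ blocks M n → w ∈ M (suc n)
  from w w∈ with ∈-blocks⁻ {M} {n} w∈
  ... | s , w′ , eq , w′∈ with Equivalence.to (enum _ w′) w′∈
  ...   | perm , nc = subst (_∈ M (suc n)) (sym eq)
    (Equivalence.from (enum (suc n) _) (attach-isPerm s perm , attach-avoids s w′ nc))

-- The exceptional word

from : ℕ → ℕ → List ℕ
from a zero    = []
from a (suc l) = a ∷ from (suc a) l

-- The only word that begins with the pattern while its part before 0 does not
valley : ℕ → ℕ → List ℕ
valley m n = downFrom m ++ from m (suc (n ∸ m))

length-from : ∀ a l → length (from a l) ≡ l
length-from a zero    = refl
length-from a (suc l) = cong suc (length-from (suc a) l)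

from-≥ : ∀ a l → All (a ≤_) (from a l)
from-≥ a zero    = []
from-≥ a (suc l) = ℕ.≤-refl ∷ All.map ℕ.<⇒≤ (from-≥ (suc a) l)

from-< : ∀ a l {b} → l + a ≤ b → All (_< b) (from a l)
from-< a zero    _ = []
from-< a (suc l) p =
  ℕ.≤-trans (ℕ.m≤n+m (suc a) l) p′ ∷ from-< (suc a) l p′
  where p′ = ℕ.≤-trans (ℕ.≤-reflexive (ℕ.+-suc l a)) p

from-increasing : ∀ a l → AllPairs _<_ (from a l)
from-increasing a zero    = []
from-increasing a (suc l) = from-≥ (suc a) l ∷ from-increasing (suc a) l

decreasing-length : ∀ {a d} → AllPairs _>_ d → All (a >_) d → length d ≤ a
decreasing-length []          []        = z≤n
decreasing-length (x>d ∷ dec) (a>x ∷ _) = ℕ.≤-<-trans (decreasing-length dec x>d) a>x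

-- The equality case of `decreasing-length`: a decreasing word of a letters below a must use all of
-- them.
decreasing-full : ∀ {a d} → AllPairs _>_ d → All (a >_) d → length d ≡ a → d ≡ downFrom a
decreasing-full []          []        refl = refl
decreasing-full {d = _ ∷ d} (x>d ∷ dec) (a>x ∷ _) refl
  with refl ← ℕ.≤-antisym (decreasing-length dec x>d) (ℕ.≤-pred a>x)
  = cong (length d ∷_) (decreasing-full dec x>d refl)

increasing-length : ∀ {a b v} → a ≤ b → AllPairs _<_ v → All (a ≤_) v → All (_< b) v → length v + a ≤ b
increasing-length a≤b []                  []        []          = a≤b
increasing-length a≤b (x<v ∷ inc) (a≤x ∷ _) (x<b ∷ v<b) =
  ℕ.≤-trans (ℕ.≤-reflexive (sym (ℕ.+-suc _ _)))
    (ℕ.≤-trans (ℕ.+-monoʳ-≤ _ (s≤s a≤x)) (increasing-length x<b inc x<v v<b))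

increasing-full : ∀ {a b v} → AllPairs _<_ v → All (a ≤_) v → All (_< b) v → length v + a ≡ b →
                  v ≡ from a (length v)
increasing-full []          []        []          _    = refl
increasing-full {a} {v = x ∷ v} (x<v ∷ inc) (a≤x ∷ _) (x<b ∷ v<b) refl
  with refl ← ℕ.≤-antisym a≤x (ℕ.≤-pred (ℕ.+-cancelˡ-≤ (length v) _ _
    (ℕ.≤-trans (increasing-length x<b inc x<v v<b) (ℕ.≤-reflexive (sym (ℕ.+-suc _ _))))))
  = cong (a ∷_) (increasing-full inc x<v v<b (ℕ.+-suc _ _))

-- The decreasing `d` below `y` has at most y letters, and the increasing `y ∷ v` has at most n+1-y.
-- The lengths add up to n+1, so both bounds are attained and both words are full runs.
valley-characterisation : ∀ {n d y v} → AllPairs _>_ d → All (y >_) d → AllPairs _<_ (y ∷ v) →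
  IsPerm (suc n) (d ++ y ∷ v) → length d ≤ n × d ++ y ∷ v ≡ valley (length d) n
valley-characterisation {n} {d} {y} {v} dec y>d inc@(y<v ∷ _) (isPerm len bound _) = d≤n ,
  cong₂ _++_ (trans (decreasing-full dec y>d d≡y) (cong downFrom (sym d≡y)))
    (trans (increasing-full inc y≤v v<n (trans (ℕ.+-comm _ (length d)) length-sum))
           (cong (from (length d)) lv))
  where
  length-sum : length d + length (y ∷ v) ≡ suc n
  length-sum = trans (sym (List.length-++ d)) len

  v<n : All (_< suc n) (y ∷ v)
  v<n = All.++⁻ʳ d bound

  d≡y : length d ≡ y
  d≡y = ℕ.≤-antisym (decreasing-length dec y>d) (ℕ.+-cancelˡ-≤ (length (y ∷ v)) _ _
    (ℕ.≤-trans (increasing-length (ℕ.<⇒≤ (All.head v<n)) inc (ℕ.≤-refl ∷ All.map ℕ.<⇒≤ y<v) v<n)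
               (ℕ.≤-reflexive (trans (sym length-sum) (ℕ.+-comm (length d) _)))))

  y≤v : All (length d ≤_) (y ∷ v)
  y≤v = subst (λ z → All (z ≤_) (y ∷ v)) (sym d≡y) (ℕ.≤-refl ∷ All.map ℕ.<⇒≤ y<v)

  length-sum′ : length d + length v ≡ n
  length-sum′ = ℕ.suc-injective (trans (sym (ℕ.+-suc (length d) _)) length-sum)

  d≤n : length d ≤ n
  d≤n = subst (length d ≤_) length-sum′ (ℕ.m≤m+n (length d) _)

  lv : length (y ∷ v) ≡ suc (n ∸ length d)
  lv = cong suc (trans (sym (ℕ.m+n∸m≡n (length d) (length v))) (cong (_∸ length d) length-sum′))

valley-isPerm : ∀ {m n} → m ≤ n → IsPerm (suc n) (valley m n)
valley-isPerm {m} {n} m≤n = isPerm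
  (trans (List.length-++ (downFrom m))
    (trans (cong₂ _+_ (List.length-downFrom m) (length-from m (suc (n ∸ m))))
      (trans (ℕ.+-suc m _) (cong suc (ℕ.m+[n∸m]≡n m≤n)))))
  (All.++⁺ (All.tabulate λ x∈ → ℕ.<-trans (∈-downFrom⁻ x∈) (s≤s m≤n))
    (from-< m (suc (n ∸ m)) (s≤s (ℕ.≤-reflexive (ℕ.m∸n+n≡m m≤n)))))
  (Unique.++⁺ (Unique.downFrom⁺ m) (increasing⇒unique (from-increasing m (suc (n ∸ m))))
    λ (z∈ , z∈′) → ℕ.<⇒≱ (∈-downFrom⁻ z∈) (All.lookup (from-≥ m (suc (n ∸ m))) z∈′))

-- A descent starting in `d` ends below `x`, because all of `d` lies below `x`; one starting in `v`
-- does not exist.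
¬descentAbove-valley : ∀ {x d v} → All (x >_) d → AllPairs _<_ v → ¬ DescentAbove x (d ++ v)
¬descentAbove-valley []             inc a                                  = increasing⇒¬descentAbove inc a
¬descentAbove-valley {d = _ ∷ []}    (y<x ∷ _)       _   (here x<z z<y) = ℕ.<-asym x<z (ℕ.<-trans z<y y<x)
¬descentAbove-valley {d = _ ∷ _ ∷ _} (_ ∷ z<x ∷ _) _   (here x<z _)   = ℕ.<-asym x<z z<x
¬descentAbove-valley (_ ∷ d<x)                         inc (there a)      = ¬descentAbove-valley d<x inc a

¬contains-valley : ∀ {d v} → AllPairs _>_ d → AllPairs _<_ v → ¬ Contains (d ++ v)
¬contains-valley []          inc c         = increasing⇒¬contains inc c
¬contains-valley (x>d ∷ _)   inc (here a)  = ¬descentAbove-valley x>d inc a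
¬contains-valley (_ ∷ dec)   inc (there c) = ¬contains-valley dec inc c

valley-avoids : ∀ m n → ¬ Contains (valley m n)
valley-avoids m n = ¬contains-valley (AllPairs.applyDownFrom⁺₁ id m (λ j<i _ → j<i)) (from-increasing m (suc (n ∸ m)))

valley-begins : ∀ m n → Begins m (valley m n)
valley-begins m n = m , begin-downFrom m ℕ.≤-refl
  where
  begin-downFrom : ∀ m {h y w} → m ≤ h → Begin m h y (downFrom m ++ y ∷ w)
  begin-downFrom zero    _   = last
  begin-downFrom (suc m) m<h = m<h ∷ begin-downFrom m ℕ.≤-refl

position-0-valley : ∀ {u v w} m → All (0 <_) u → u ++ 0 ∷ v ≡ downFrom (suc m) ++ w → length u ≡ m
position-0-valley zero    []        _    = refl
position-0-valley zero    (() ∷ _)  refl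
position-0-valley (suc m) []        ()
position-0-valley (suc m) (_ ∷ 0<u) eq = cong suc (position-0-valley m 0<u (List.∷-injectiveʳ eq))

-- In the valley exactly m letters precede 0, whereas `attach s w` puts all of `w` before 0, and `w`
-- has more than m+1 letters as it begins with the pattern.
attach≢valley : ∀ {m n k} (s : Choice n) {w} → Begins (suc m) w → attach s w ≢ valley (suc m) k
attach≢valley {m} s {w} (_ , b) eq = ℕ.<-irrefl
  (trans (sym (position-0-valley m (map-suc∘-positive (skip s) w) eq)) (List.length-map (suc ∘ skip s) w))
  (ℕ.<-trans (ℕ.n<1+n m) (begin-length b))

begin-positive : ∀ {m h y w} → Begin (suc m) h y w → 0 < h
begin-positive (x<h ∷ _) = ℕ.≤-<-trans z≤n x<h

-- When the initial segment crosses the 0, its run is everything up to and including 0 and its last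
-- letter heads the increasing block. The word then has the shape that `valley-characterisation`
-- determines.
attach-begins⁻ : ∀ {m n} (s : Choice n) w → IsPerm (suc n) (attach s w) → Begins (suc m) (attach s w) →
                 Begins (suc m) w ⊎ (suc m ≤ n × attach s w ≡ valley (suc m) n)
attach-begins⁻ {m} {n} s w perm (y , b)
  -- Here k ≥ 2 matters: some letter precedes `y` and is smaller, so `y` is not 0.
  with begin-++-0 (map (suc ∘ skip s) w) (begin-positive b) b
... | inj₁ b′ = inj₁ (SkipRelabel.begins-map⁻ s w (y , b′))
... | inj₂ (dec , y>d , m≡ , v′ , v≡) = inj₂ (proj₁ result′ , trans attach≡ (proj₂ result′))
  where
  d = map (suc ∘ skip s) w ++ [ 0 ]
  attach≡ : attach s w ≡ d ++ y ∷ v′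
  attach≡ = trans (sym (List.++-assoc (map (suc ∘ skip s) w) [ 0 ] _)) (cong (d ++_) v≡)
  result : length d ≤ n × d ++ y ∷ v′ ≡ valley (length d) n
  result = valley-characterisation dec y>d
    (subst (AllPairs _<_) v≡ (increasing-map-suc (increasing-ones s)))
    (subst (IsPerm (suc n)) attach≡ perm)
  result′ : suc m ≤ n × d ++ y ∷ v′ ≡ valley (suc m) n
  result′ = subst (λ k → k ≤ n × d ++ y ∷ v′ ≡ valley k n) (sym m≡) result

valleys : ℕ → ℕ → List (List ℕ)
valleys m n = if m ≤ᵇ n then [ valley m n ] else []

∈-valleys⁺ : ∀ {m n} → m ≤ n → valley m n ∈ valleys m n
∈-valleys⁺ {m} {n} m≤n with m ≤ᵇ n | ℕ.≤⇒≤ᵇ m≤n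
... | true | _ = here refl

∈-valleys⁻ : ∀ m n {w} → w ∈ valleys m n → m ≤ n × w ≡ valley m n
∈-valleys⁻ m n w∈ with m ≤ᵇ n | ℕ.≤ᵇ⇒≤ m n
∈-valleys⁻ m n (here refl) | true | le = le _ , refl

valleys-unique : ∀ m n → Unique (valleys m n)
valleys-unique m n with m ≤ᵇ n
... | true  = [] ∷ []
... | false = []

length-valleys : ∀ m n → length (valleys m n) ≡ (if m ≤ᵇ n then 1 else 0)
length-valleys m n with m ≤ᵇ n
... | true  = refl
... | false = refl

begins-recurrence : ∀ {M} m → Enumerates M (λ n w → IsPerm n w × ¬ Contains w × Begins (suc m) w) →
                    ∀ n → length (M (suc n)) ≡ binomialTransform n (length ∘ M) + (if suc m ≤ᵇ n then 1 else 0)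
begins-recurrence {M} m (uniq , enum) n = begin
  length (M (suc n))
    ≡⟨ unique-length (uniq (suc n)) union-unique (λ w → mk⇔ (to w) (from′ w)) ⟩
  length (blocks M n ++ valleys (suc m) n)
    ≡⟨ List.length-++ (blocks M n) ⟩
  length (blocks M n) + length (valleys (suc m) n)
    ≡⟨ cong₂ _+_ (length-blocks M n) (length-valleys (suc m) n) ⟩
  binomialTransform n (length ∘ M) + (if suc m ≤ᵇ n then 1 else 0) ∎
  where
  open ≡.≡-Reasoning

  union-unique : Unique (blocks M n ++ valleys (suc m) n)
  union-unique = Unique.++⁺ (blocks-unique uniq n) (valleys-unique (suc m) n) disjoint
    where
    disjoint : Disjoint (blocks M n) (valleys (suc m) n)
    disjoint (w∈ , w∈′) with ∈-blocks⁻ {M} {n} w∈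
    ... | s , w′ , eq , w′∈ = attach≢valley {k = n} s
      (proj₂ (proj₂ (Equivalence.to (enum _ w′) w′∈))) (trans (sym eq) (proj₂ (∈-valleys⁻ (suc m) n w∈′)))

  to : ∀ w → w ∈ M (suc n) → w ∈ blocks M n ++ valleys (suc m) n
  to w w∈ with Equivalence.to (enum (suc n) w) w∈
  ... | perm , nc , begins with detach perm nc
  ...   | s , w′ , eq , perm′ , nc′
    with attach-begins⁻ s w′ (subst (IsPerm (suc n)) eq perm) (subst (Begins (suc m)) eq begins)
  ...     | inj₁ begins′    = ∈-++⁺ˡ (subst (_∈ blocks M n) (sym eq)
    (∈-blocks⁺ {M} s (Equivalence.from (enum _ w′) (perm′ , nc′ , begins′))))
  ...     | inj₂ (m<n , eq′) =
    ∈-++⁺ʳ (blocks M n) (subst (_∈ valleys (suc m) n) (sym (trans eq eq′)) (∈-valleys⁺ m<n))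

  from′ : ∀ w → w ∈ blocks M n ++ valleys (suc m) n → w ∈ M (suc n)
  from′ w w∈ with ∈-++⁻ (blocks M n) w∈
  ... | inj₂ w∈valleys with ∈-valleys⁻ (suc m) n w∈valleys
  ...   | m<n , eq = subst (_∈ M (suc n)) (sym eq) (Equivalence.from (enum (suc n) _)
    (valley-isPerm m<n , valley-avoids (suc m) n , valley-begins (suc m) n))
  from′ w w∈ | inj₁ w∈blocks with ∈-blocks⁻ {M} {n} w∈blocks
  ...   | s , w′ , eq , w′∈ with Equivalence.to (enum _ w′) w′∈
  ...     | perm , nc , (y , b) = subst (_∈ M (suc n)) (sym eq) (Equivalence.from (enum (suc n) _)
    (attach-isPerm s perm , attach-avoids s w′ nc , _ , begin-++⁺ˡ (SkipRelabel.begin-map⁺ s b)))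

-- Words as lists of letters

letters : ∀ {m n} → Vec (Fin m) n → List ℕ
letters []      = []
letters (x ∷ π) = toℕ x ∷ letters π

letters-injective : ∀ {m n} (π ρ : Vec (Fin m) n) → letters π ≡ letters ρ → π ≡ ρ
letters-injective []      []      _  = refl
letters-injective (x ∷ π) (y ∷ ρ) eq with List.∷-injective eq
... | x≡y , eq′ = cong₂ _∷_ (Fin.toℕ-injective x≡y) (letters-injective π ρ eq′)

length-letters : ∀ {m n} (π : Vec (Fin m) n) → length (letters π) ≡ n
length-letters []      = refl
length-letters (x ∷ π) = cong suc (length-letters π)

letters-< : ∀ {m n} (π : Vec (Fin m) n) → All (_< m) (letters π)
letters-< []      = []
letters-< (x ∷ π) = Fin.toℕ<n x ∷ letters-< π

letters-surjective : ∀ {m} w → All (_< m) w → ∃ λ (π : Vec (Fin m) (length w)) → letters π ≡ w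
letters-surjective []      []          = [] , refl
letters-surjective (x ∷ w) (x<m ∷ w<m) with letters-surjective w w<m
... | π , eq = Fin.fromℕ< x<m ∷ π , cong₂ _∷_ (Fin.toℕ-fromℕ< x<m) eq

All-letters⁺ : ∀ {m n} {P : ℕ → Set} {π : Vec (Fin m) n} → VecAll.All (P ∘ toℕ) π → All P (letters π)
All-letters⁺ VecAll.[]       = []
All-letters⁺ (p VecAll.∷ ps) = p ∷ All-letters⁺ ps

All-letters⁻ : ∀ {m n} {P : ℕ → Set} (π : Vec (Fin m) n) → All P (letters π) → VecAll.All (P ∘ toℕ) π
All-letters⁻ []      []       = VecAll.[]
All-letters⁻ (_ ∷ π) (p ∷ ps) = p VecAll.∷ All-letters⁻ π ps

unique-letters⁺ : ∀ {m n} {π : Vec (Fin m) n} → VecUnique π → Unique (letters π)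
unique-letters⁺ VecAllPairs.[]       = []
unique-letters⁺ (p VecAllPairs.∷ ps) =
  All-letters⁺ (VecAll.map (λ x≢y → x≢y ∘ Fin.toℕ-injective) p) ∷ unique-letters⁺ ps

unique-letters⁻ : ∀ {m n} (π : Vec (Fin m) n) → Unique (letters π) → VecUnique π
unique-letters⁻ []      []       = VecAllPairs.[]
unique-letters⁻ (_ ∷ π) (p ∷ ps) =
  VecAll.map (λ x≢y → x≢y ∘ cong toℕ) (All-letters⁻ π p) VecAllPairs.∷ unique-letters⁻ π ps

isPermutation⇔isPerm : ∀ {n} (π : Word n) → IsPermutation π ⇔ IsPerm n (letters π)
isPermutation⇔isPerm π = mk⇔
  (λ u → isPerm (length-letters π) (letters-< π) (unique-letters⁺ u))
  (λ p → unique-letters⁻ π (IsPerm.distinct p))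

∈-words : ∀ {m n} (π : Vec (Fin m) n) → π ∈ words m n
∈-words []      = here refl
∈-words (x ∷ π) = ∈-cartesianProductWith⁺ _∷_ (∈-allFin x) (∈-words π)

words-unique : ∀ m n → Unique (words m n)
words-unique m zero    = [] ∷ []
words-unique m (suc n) =
  Unique.cartesianProductWith⁺ _∷_ Vec.∷-injective (Unique.allFin⁺ m) (words-unique m n)

-- Occurrences of 1-32

true-⇔ : ∀ {a b} {A : Set a} {B : Set b} → A → B → A ⇔ B
true-⇔ a b = mk⇔ (λ _ → b) (λ _ → a)

false-⇔ : ∀ {a b} {A : Set a} {B : Set b} → ¬ A → ¬ B → A ⇔ B
false-⇔ ¬a ¬b = mk⇔ (⊥-elim ∘ ¬a) (⊥-elim ∘ ¬b)

orderIsomorphic-132 : ∀ {m} (x y z : Fin m) →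
  OrderIsomorphic (toℕ ∘ lookup (x ∷ y ∷ z ∷ [])) (lookup (1 ∷ 3 ∷ 2 ∷ [])) ⇔
  (toℕ x < toℕ z × toℕ z < toℕ y)
orderIsomorphic-132 x y z = mk⇔
  (λ iso → Equivalence.from (iso 0F 2F) (s<s z<s) ,
           Equivalence.from (iso 2F 1F) (s<s (s<s z<s)))
  iso
  where
  iso : toℕ x < toℕ z × toℕ z < toℕ y →
        OrderIsomorphic (toℕ ∘ lookup (x ∷ y ∷ z ∷ [])) (lookup (1 ∷ 3 ∷ 2 ∷ []))
  iso (x<z , z<y) = go
    where
    x<y = ℕ.<-trans x<z z<y
    go : OrderIsomorphic (toℕ ∘ lookup (x ∷ y ∷ z ∷ [])) (lookup (1 ∷ 3 ∷ 2 ∷ []))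
    go 0F 0F = false-⇔ (ℕ.<-irrefl refl) (ℕ.<-irrefl refl)
    go 0F 1F = true-⇔ x<y (s<s z<s)
    go 0F 2F = true-⇔ x<z (s<s z<s)
    go 1F 0F = false-⇔ (ℕ.<-asym x<y) (λ { (s≤s ()) })
    go 1F 1F = false-⇔ (ℕ.<-irrefl refl) (ℕ.<-irrefl refl)
    go 1F 2F = false-⇔ (ℕ.<-asym z<y) (λ { (s≤s (s≤s ())) })
    go 2F 0F = false-⇔ (ℕ.<-asym x<z) (λ { (s≤s ()) })
    go 2F 1F = true-⇔ z<y (s<s (s<s z<s))
    go 2F 2F = false-⇔ (ℕ.<-irrefl refl) (ℕ.<-irrefl refl)

descentAbove-letters⁺ : ∀ {m n x} (π : Vec (Fin m) n) j j′ → toℕ j′ ≡ suc (toℕ j) →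
  x < toℕ (lookup π j′) → toℕ (lookup π j′) < toℕ (lookup π j) → DescentAbove x (letters π)
descentAbove-letters⁺ (y ∷ z ∷ π) 0F    1F _  x<z z<y = here x<z z<y
descentAbove-letters⁺ (_ ∷ π)     (Fin.suc j) (Fin.suc j′)       eq x<z z<y =
  there (descentAbove-letters⁺ π j j′ (ℕ.suc-injective eq) x<z z<y)

descentAbove-letters⁻ : ∀ {m n x} (π : Vec (Fin m) n) → DescentAbove x (letters π) →
  ∃₂ λ j j′ → toℕ j′ ≡ suc (toℕ j) × x < toℕ (lookup π j′) × toℕ (lookup π j′) < toℕ (lookup π j)
descentAbove-letters⁻ (_ ∷ [])    (there ())
descentAbove-letters⁻ (_ ∷ _ ∷ _) (here x<z z<y) = 0F , 1F , refl , x<z , z<y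
descentAbove-letters⁻ (_ ∷ _ ∷ π) (there d)      with descentAbove-letters⁻ (_ ∷ π) d
... | j , j′ , eq , x<z , z<y = Fin.suc j , Fin.suc j′ , cong suc eq , x<z , z<y

contains-letters⁺ : ∀ {m n} (π : Vec (Fin m) n) i j j′ → i Fin.< j → toℕ j′ ≡ suc (toℕ j) →
  toℕ (lookup π i) < toℕ (lookup π j′) → toℕ (lookup π j′) < toℕ (lookup π j) → Contains (letters π)
contains-letters⁺ (_ ∷ π) 0F    (Fin.suc j) (Fin.suc j′) _   eq x<z z<y =
  here (descentAbove-letters⁺ π j j′ (ℕ.suc-injective eq) x<z z<y)
contains-letters⁺ (_ ∷ π) (Fin.suc i) (Fin.suc j) (Fin.suc j′) i<j eq x<z z<y =
  there (contains-letters⁺ π i j j′ (s<s⁻¹ i<j) (ℕ.suc-injective eq) x<z z<y)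

contains-letters⁻ : ∀ {m n} (π : Vec (Fin m) n) → Contains (letters π) →
  ∃₂ λ i j → ∃ λ j′ → i Fin.< j × toℕ j′ ≡ suc (toℕ j) ×
    toℕ (lookup π i) < toℕ (lookup π j′) × toℕ (lookup π j′) < toℕ (lookup π j)
contains-letters⁻ (_ ∷ π) (here d)  with descentAbove-letters⁻ π d
... | j , j′ , eq , p = 0F , Fin.suc j , Fin.suc j′ , z<s , cong suc eq , p
contains-letters⁻ (_ ∷ π) (there c) with contains-letters⁻ π c
... | i , j , j′ , i<j , eq , p = Fin.suc i , Fin.suc j , Fin.suc j′ , s<s i<j , cong suc eq , p

contains1-32⇔contains : ∀ {n} (π : Word n) → Contains1-32 π ⇔ Contains (letters π)
contains1-32⇔contains π = mk⇔
  (λ (i , j , j′ , i<j , eq , iso) →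
    let x<z , z<y = Equivalence.to (orderIsomorphic-132 (lookup π i) (lookup π j) (lookup π j′)) iso
    in contains-letters⁺ π i j j′ i<j eq x<z z<y)
  (λ c → let i , j , j′ , i<j , eq , p = contains-letters⁻ π c in
    i , j , j′ , i<j , eq ,
    Equivalence.from (orderIsomorphic-132 (lookup π i) (lookup π j) (lookup π j′)) p)

-- Initial segments

-- The pattern with its last letter `c` freed from m, so that removing the first letter leaves the
-- same shape with the same `c`; `decreasingThenMax k` is the case m = k-1, `c` = k.
descentThen : ℕ → ℕ → List ℕ
descentThen m c = map suc (downFrom m) ++ [ c ]

last-∈ : ∀ m c → c ∈ descentThen m c
last-∈ m c = ∈-++⁺ʳ (map suc (downFrom m)) (here refl)

-- The last two hypotheses replace the letters already read: `h` is the last of them, and `y` is the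
-- letter that must stand at the position of `c`. In the recursion the head `x` becomes the new
-- bound.
descentThen⇒begin : ∀ {l n} m c (π : Vec (Fin l) n) (k≤n : length (descentThen m c) ≤ n) h y →
  let f = λ i → toℕ (lookup π (inject≤ i k≤n)) ; p = List.lookup (descentThen m c) in
  (∀ i j → p i < p j → f i < f j) → (∀ i → p i ≤ m → f i < h) → (∀ i → p i ≡ c → f i ≡ y) →
  Begin m h y (letters π)
descentThen⇒begin zero    c (x ∷ π) k≤n h y _    _  f≡y with f≡y 0F refl
... | refl = last
descentThen⇒begin (suc m) c (x ∷ π) k≤n h y mono lt f≡y = lt 0F ℕ.≤-refl ∷
  descentThen⇒begin m c π (ℕ.≤-pred k≤n) (toℕ x) y
    (λ i j → mono (Fin.suc i) (Fin.suc j))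
    (λ i pi≤m → mono (Fin.suc i) 0F (s≤s pi≤m))
    (λ i → f≡y (Fin.suc i))

-- The induction also returns, for each position, whether its letter belongs to the decreasing run
-- or is the top. This is what compares a newly added head with the letters after it.
begin⇒descentThen : ∀ {l n} m c (π : Vec (Fin l) n) h y → m < c → h ≤ y → Begin m h y (letters π) →
  let p = List.lookup (descentThen m c) in
  ∃ λ (k≤n : length (descentThen m c) ≤ n) → let f = λ i → toℕ (lookup π (inject≤ i k≤n)) in
    OrderIsomorphic f p × (∀ i → (p i ≤ m × f i < h) ⊎ (p i ≡ c × f i ≡ y))
begin⇒descentThen zero    c (x ∷ π) h _ m<c h≤y last = s≤s z≤n , iso , bounds
  where
  iso : OrderIsomorphic _ _
  iso 0F 0F = false-⇔ (ℕ.<-irrefl refl) (ℕ.<-irrefl refl)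
  bounds : ∀ i → _
  bounds 0F = inj₂ (refl , refl)
begin⇒descentThen (suc m) c (x ∷ π) h y m<c h≤y (x<h ∷ b)
  with begin⇒descentThen m c π (toℕ x) y (ℕ.<-trans (ℕ.n<1+n m) m<c) (ℕ.<⇒≤ (ℕ.<-≤-trans x<h h≤y)) b
... | k≤n , iso , bounds = s≤s k≤n , iso′ , bounds′
  where
  x<y = ℕ.<-≤-trans x<h h≤y

  iso′ : OrderIsomorphic _ _
  iso′ 0F    0F    = false-⇔ (ℕ.<-irrefl refl) (ℕ.<-irrefl refl)
  iso′ (Fin.suc i) (Fin.suc j) = iso i j
  iso′ 0F    (Fin.suc j) with bounds j
  ... | inj₁ (p≤m , f<x) = false-⇔ (ℕ.<-asym f<x) (ℕ.<-asym (s≤s p≤m))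
  ... | inj₂ (p≡c , f≡y) = true-⇔ (subst (toℕ x <_) (sym f≡y) x<y) (subst (suc m <_) (sym p≡c) m<c)
  iso′ (Fin.suc i) 0F    with bounds i
  ... | inj₁ (p≤m , f<x) = true-⇔ f<x (s≤s p≤m)
  ... | inj₂ (p≡c , f≡y) = false-⇔ (ℕ.<-asym (subst (toℕ x <_) (sym f≡y) x<y))
                                   (ℕ.<-asym (subst (suc m <_) (sym p≡c) m<c))

  bounds′ : ∀ i → _
  bounds′ 0F    = inj₁ (ℕ.≤-refl , x<h)
  bounds′ (Fin.suc i) with bounds i
  ... | inj₁ (p≤m , f<x) = inj₁ (ℕ.m≤n⇒m≤1+n p≤m , ℕ.<-trans f<x x<h)
  ... | inj₂ eqs         = inj₂ eqs

beginsWith-decreasingThenMax : ∀ m {n} (π : Word n) →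
  BeginsWith (decreasingThenMax (suc (suc m))) π ⇔ Begins (suc m) (letters π)
beginsWith-decreasingThenMax m {n} π = mk⇔ to from′
  where
  c = suc (suc m)
  p = List.lookup (descentThen (suc m) c)

  to : BeginsWith (descentThen (suc m) c) π → Begins (suc m) (letters π)
  to (inj₂ (() , _))
  to (inj₁ (k≤n , iso)) = f l , descentThen⇒begin (suc m) c π k≤n (f l) (f l)
    (λ i j → Equivalence.from (iso i j))
    (λ i pi≤ → Equivalence.from (iso i l) (subst (p i <_) (sym pl≡c) (s≤s pi≤)))
    (λ i pi≡c → order-reflects-≡ i l (trans pi≡c (sym pl≡c)))
    where
    f = λ i → toℕ (lookup π (inject≤ i k≤n))
    -- The position of the largest pattern letter; its letter serves both as the top and as the
    -- initial bound.
    l = index (last-∈ (suc m) c)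
    pl≡c : p l ≡ c
    pl≡c = sym (Any.lookup-index (last-∈ (suc m) c))
    order-reflects-≡ : ∀ i j → p i ≡ p j → f i ≡ f j
    order-reflects-≡ i j pi≡pj with <-cmp (f i) (f j)
    ... | tri< lt _ _ = contradiction (Equivalence.to (iso i j) lt) (ℕ.<-irrefl pi≡pj)
    ... | tri≈ _ eq _ = eq
    ... | tri> _ _ gt = contradiction (Equivalence.to (iso j i) gt) (ℕ.<-irrefl (sym pi≡pj))

  from′ : Begins (suc m) (letters π) → BeginsWith (descentThen (suc m) c) π
  from′ (y , b) with begin⇒descentThen (suc m) c π y y ℕ.≤-refl ℕ.≤-refl b
  ... | k≤n , iso , _ = inj₁ (k≤n , iso)

beginsWith-1 : ∀ {n} (π : Word n) → BeginsWith [ 1 ] π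
beginsWith-1 {zero}  π = inj₂ (refl , refl)
beginsWith-1 {suc n} π = inj₁ (s≤s z≤n , λ { 0F 0F → false-⇔ (ℕ.<-irrefl refl) (ℕ.<-irrefl refl) })

-- The recurrence for N

countedLetters : List ℕ → ℕ → List (List ℕ)
countedLetters p n = map letters (filter (counted? p) (words n n))

length-countedLetters : ∀ p n → length (countedLetters p n) ≡ N p n
length-countedLetters p n = List.length-map letters (filter (counted? p) (words n n))

counted-enumerates : ∀ p (B : List ℕ → Set) → (∀ {n} (π : Word n) → BeginsWith p π ⇔ B (letters π)) →
  Enumerates (countedLetters p) (λ n w → IsPerm n w × ¬ Contains w × B w)
counted-enumerates p B B⇔ =
  (λ n → Unique.map⁺ (letters-injective _ _) (Unique.filter⁺ (counted? p) (words-unique n n))) ,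
  (λ n w → mk⇔ (to n w) (from′ n w))
  where
  to : ∀ n w → w ∈ countedLetters p n → IsPerm n w × ¬ Contains w × B w
  to n w w∈ with ∈-map⁻ letters w∈
  ... | π , π∈ , refl with ∈-filter⁻ (counted? p) {xs = words n n} π∈
  ...   | _ , perm , av , begins =
    Equivalence.to (isPermutation⇔isPerm π) perm ,
    av ∘ Equivalence.from (contains1-32⇔contains π) ,
    Equivalence.to (B⇔ π) begins

  from′ : ∀ n w → IsPerm n w × ¬ Contains w × B w → w ∈ countedLetters p n
  from′ n w (perm@(isPerm refl bound _) , nc , b) with letters-surjective w bound
  ... | π , eq = subst (_∈ countedLetters p n) eq (∈-map⁺ letters (∈-filter⁺ (counted? p) (∈-words π)
    ( Equivalence.from (isPermutation⇔isPerm π) (subst (IsPerm n) (sym eq) perm)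
    , (λ c → nc (subst Contains eq (Equivalence.to (contains1-32⇔contains π) c)))
    , Equivalence.from (B⇔ π) (subst B (sym eq) b))))

binomialTransform-cong : ∀ n {f g} → (∀ i → f i ≡ g i) → binomialTransform n f ≡ binomialTransform n g
binomialTransform-cong zero    eq = eq 0
binomialTransform-cong (suc n) eq =
  cong₂ _+_ (binomialTransform-cong n eq) (binomialTransform-cong n (eq ∘ suc))

N-1-recurrence : ∀ n → N [ 1 ] (suc n) ≡ binomialTransform n (N [ 1 ])
N-1-recurrence n = begin
  N [ 1 ] (suc n)                                         ≡⟨ length-countedLetters [ 1 ] (suc n) ⟨
  length (countedLetters [ 1 ] (suc n))                   ≡⟨ avoider-recurrence enumerates n ⟩
  binomialTransform n (length ∘ countedLetters [ 1 ])     ≡⟨ binomialTransform-cong n (length-countedLetters [ 1 ]) ⟩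
  binomialTransform n (N [ 1 ])                           ∎
  where
  open ≡.≡-Reasoning
  enum = counted-enumerates [ 1 ] (λ _ → ⊤) (λ π → true-⇔ (beginsWith-1 π) _)
  enumerates : Enumerates (countedLetters [ 1 ]) (λ n w → IsPerm n w × ¬ Contains w)
  enumerates = proj₁ enum , λ n w → mk⇔
    (λ w∈ → let perm , nc , _ = Equivalence.to (proj₂ enum n w) w∈ in perm , nc)
    (λ (perm , nc) → Equivalence.from (proj₂ enum n w) (perm , nc , _))

N-≥2-recurrence : ∀ m n → let p = decreasingThenMax (suc (suc m)) in
  N p (suc n) ≡ binomialTransform n (N p) + (if suc m ≤ᵇ n then 1 else 0)
N-≥2-recurrence m n = begin
  N p (suc n)
    ≡⟨ length-countedLetters p (suc n) ⟨
  length (countedLetters p (suc n))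
    ≡⟨ begins-recurrence m (counted-enumerates p (Begins (suc m)) (beginsWith-decreasingThenMax m)) n ⟩
  binomialTransform n (length ∘ countedLetters p) + extra
    ≡⟨ cong (_+ extra) (binomialTransform-cong n (length-countedLetters p)) ⟩
  binomialTransform n (N p) + extra ∎
  where
  open ≡.≡-Reasoning
  extra = if suc m ≤ᵇ n then 1 else 0
  p = decreasingThenMax (suc (suc m))

N-1-0 : N [ 1 ] 0 ≡ 1
N-1-0 = refl

N-≥2-0 : ∀ m → N (decreasingThenMax (suc (suc m))) 0 ≡ 0
N-≥2-0 zero    = refl
N-≥2-0 (suc m) = refl

proposition22 : ∀ {c ℓ} (R : Exponentialℚ-Algebra c ℓ) → let open PowerSeries R in
    ∀ (k : ℕ) → 1 ≤ k →
    (2 ≤ k → E (decreasingThenMax k) ≋ (e^ (e^ X)) ⊛ ∫₀ ((e^ (⊖ (e^ X))) ⊛ expTail (k ∸ 1)))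
    × (k ≡ 1 → E (decreasingThenMax k) ≋ e^ ((e^ X) ⊖ 𝟙))
proposition22 R k _ = case≥2 k , case1
  where
  open PowerSeries R
  open SeriesProperties R

  case≥2 : ∀ k → 2 ≤ k →
    E (decreasingThenMax k) ≋ (e^ (e^ X)) ⊛ ∫₀ ((e^ (⊖ (e^ X))) ⊛ expTail (k ∸ 1))
  case≥2 (suc (suc m)) _ = egf-≥2 (suc m) (N (decreasingThenMax (suc (suc m)))) (N-≥2-0 m) (N-≥2-recurrence m)
  case≥2 (suc zero) (s≤s ())

  case1 : k ≡ 1 → E (decreasingThenMax k) ≋ e^ ((e^ X) ⊖ 𝟙)
  case1 refl = egf-1 (N [ 1 ]) N-1-0 N-1-recurrence
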